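{- Let $d\geq 3$ and $1\leq k\leq d-2$, let $P\subset\mathbb R^d$ be a $k$-simplicial $d$-polytope with a simplex facet $S$ in bounded position, and let $\mathcal F,\mathcal N\subseteq\operatorname{adj}(S)$ be disjoint with $\mathcal F$ nonsimple. Then for every $v\in V_S(\mathcal F,\mathcal N;P)$ the polytope $\operatorname{conv}(P\cup\{v\})$ is $k$-simplicial.
   Context: A polytope is $k$-simplicial if all its $k$-dimensional faces are $k$-simplices. For a facet $F$ of a $d$-polytope $P\subset\mathbb R^d$ let $H_F=\{x:\langle x,a_F\rangle=\ell_F\}$ be its affine hull, oriented so that $P\subseteq\{x:\langle x,a_F\rangle\geq\ell_F\}$; put $H_F^+=\{x:\langle x,a_F\rangle>\ell_F\}$, $H_F^-=\{x:\langle x,a_F\rangle<\ell_F\}$. Two facets are adjacent if they share a ridge; $\operatorname{adj}(S)$ is the set of facets adjacent to $S$. A simplex facet is a facet combinatorially equivalent to a $(d-1)$-simplex. A facet $S$ is in bounded position if for every set of $d$ facets in $\operatorname{adj}(S)$ their hyperplanes intersect in a point of $H_S^-$. A subset $\mathcal F\subseteq\operatorname{adj}(S)$ is nonsimple if there is no pair of adjacent facets $G,G'\in\mathcal F$ having a common $(d-3)$-face with $S$. For disjoint $\mathcal F,\mathcal N\subseteq\operatorname{adj}(S)$, $V_S(\mathcal F,\mathcal N;P)$ is the set of points lying in $H_F^-$ for $F\in\mathcal N\cup\{S\}$, in $H_F$ for $F\in\mathcal F$, and in $H_F^+$ for all other facets $F$ of $P$. -}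

module Defs where

open import Level using (0ℓ)
open import Algebra.Bundles using (CommutativeRing)
open import Data.Fin.Base using (Fin)
open import Data.Nat.Base using (ℕ; suc; _∸_)
open import Data.Product.Base using (_×_; ∃-syntax; Σ-syntax)
open import Data.Sum.Base using (_⊎_)
open import Data.Vec.Functional using (Vector)
open import Function.Definitions using (Injective)
open import Relation.Binary.Core using (Rel)
open import Relation.Binary.Morphism.Structures using (IsOrderIsomorphism)
open import Relation.Binary.PropositionalEquality.Core using (_≡_)
open import Relation.Binary.Structures using (IsTotalOrder)
open import Relation.Nullary.Negation.Core using (¬_)
open import Relation.Unary using (Pred; _∈_; _∉_; _⊆_; _≐_; _∩_)

import Algebra.Properties.Semiring.Sum as SemiringSum

-- The axioms of the classical real line, which determine it up to isomorphism.
-- The supremum is required in its approximation form.  Together with totality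
-- this entails excluded middle for Set₀ (consider the supremum of
-- {0} ∪ {1 ∣ A holds}), and conversely, given excluded middle, the Cauchy reals
-- form a model.
record CompleteOrderedField : Set₁ where
  field
    commutativeRing : CommutativeRing 0ℓ 0ℓ

  open CommutativeRing commutativeRing public

  infix 4 _≤_ _<_

  field
    _≤_          : Rel Carrier 0ℓ
    0≉1          : ¬ 0# ≈ 1#
    inverse      : ∀ x → ¬ x ≈ 0# → ∃[ y ] x * y ≈ 1#
    isTotalOrder : IsTotalOrder _≈_ _≤_
    +-monoʳ-≤    : ∀ z {x y} → x ≤ y → z + x ≤ z + y
    *-nonNeg     : ∀ {x y} → 0# ≤ x → 0# ≤ y → 0# ≤ x * y

  _<_ : Rel Carrier 0ℓ
  x < y = x ≤ y × ¬ x ≈ y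

  field
    supremum : (A : Pred Carrier 0ℓ) →
               ∃[ a ] a ∈ A →
               ∃[ b ] (∀ {a} → a ∈ A → a ≤ b) →
               ∃[ s ] (∀ {a} → a ∈ A → a ≤ s)
                    × (∀ {b} → b < s → ∃[ a ] a ∈ A × b < a)

module Geometry (𝓡 : CompleteOrderedField) where

  open CompleteOrderedField 𝓡 renaming (Carrier to ℝ)
  open SemiringSum semiring using (sum)

  Point : ℕ → Set
  Point d = Vector ℝ d

  private variable
    d n : ℕ

  infix 4 _≈ᵖ_

  _≈ᵖ_ : Rel (Point d) 0ℓ
  x ≈ᵖ y = ∀ i → x i ≈ y i

  ⟨_,_⟩ : Point d → Point d → ℝ
  ⟨ x , y ⟩ = sum λ i → x i * y i

  combination : Vector ℝ n → Vector (Point d) n → Point d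
  combination c p j = sum λ i → c i * p i j

  singleton : Point d → Pred (Point d) 0ℓ
  singleton v x = x ≈ᵖ v

  range : Vector (Point d) n → Pred (Point d) 0ℓ
  range p x = ∃[ i ] x ≈ᵖ p i

  aff : Pred (Point d) 0ℓ → Pred (Point d) 0ℓ
  aff {d} X x =
    ∃[ n ] Σ[ p ∈ Vector (Point d) n ] Σ[ c ∈ Vector ℝ n ]
      (∀ i → p i ∈ X) × sum c ≈ 1# × x ≈ᵖ combination c p

  conv : Pred (Point d) 0ℓ → Pred (Point d) 0ℓ
  conv {d} X x =
    ∃[ n ] Σ[ p ∈ Vector (Point d) n ] Σ[ c ∈ Vector ℝ n ]
      (∀ i → p i ∈ X) × (∀ i → 0# ≤ c i) × sum c ≈ 1# × x ≈ᵖ combination c p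

  AffinelyIndependent : Vector (Point d) n → Set
  AffinelyIndependent {d} {n} p =
    (c : Vector ℝ n) → sum c ≈ 0# → combination c p ≈ᵖ (λ _ → 0#) → ∀ i → c i ≈ 0#

  -- X contains an affine basis of its affine hull with k + 1 elements.  The
  -- empty set, of dimension -1, has no dimension in this sense.
  HasDim : Pred (Point d) 0ℓ → ℕ → Set
  HasDim {d} X k =
    Σ[ p ∈ Vector (Point d) (suc k) ]
      (∀ i → p i ∈ X) × AffinelyIndependent p × X ⊆ aff (range p)

  IsPolytope : Pred (Point d) 0ℓ → Set
  IsPolytope {d} X = ∃[ n ] Σ[ p ∈ Vector (Point d) n ] X ≐ conv (range p)

  IsSimplex : ℕ → Pred (Point d) 0ℓ → Set
  IsSimplex {d} k X =
    Σ[ p ∈ Vector (Point d) (suc k) ] AffinelyIndependent p × X ≐ conv (range p)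

  -- A face of X is the part of X on which a valid linear inequality is tight.
  -- Normal 0 is allowed, which makes X itself and the empty set faces.  A face
  -- is presented by an inequality; different inequalities may present the same
  -- face, so faces are compared by _≋_ below.
  record Face (X : Pred (Point d) 0ℓ) : Set where
    field
      normal : Point d
      offset : ℝ
      valid  : ∀ {x} → x ∈ X → offset ≤ ⟨ x , normal ⟩

    H H⁺ H⁻ : Pred (Point d) 0ℓ
    H  x = ⟨ x , normal ⟩ ≈ offset
    H⁺ x = offset < ⟨ x , normal ⟩
    H⁻ x = ⟨ x , normal ⟩ < offset

    points : Pred (Point d) 0ℓ
    points = X ∩ H

  infix 4 _≋_ _⊑_

  _≋_ _⊑_ : {X : Pred (Point d) 0ℓ} → Rel (Face X) 0ℓ
  F ≋ G = Face.points F ≐ Face.points G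
  F ⊑ G = Face.points F ⊆ Face.points G

  CombinatoriallyEquivalent : Pred (Point d) 0ℓ → Pred (Point d) 0ℓ → Set
  CombinatoriallyEquivalent X Y =
    Σ[ φ ∈ (Face X → Face Y) ] IsOrderIsomorphism _≋_ _≋_ _⊑_ _⊑_ φ

  IsSimplicial : ℕ → Pred (Point d) 0ℓ → Set
  IsSimplicial k X = (F : Face X) → HasDim (Face.points F) k → IsSimplex k (Face.points F)

  -- If X has dimension d, then the normal of a facet is nonzero and H is the
  -- affine hull of the facet; normal and offset are then unique up to a common
  -- positive factor, so that H, H⁺ and H⁻ depend only on the set of points.
  record Facet (X : Pred (Point d) 0ℓ) : Set where
    field
      face : Face X
      dim  : HasDim (Face.points face) (d ∸ 1)

    open Face face public

  infix 4 _≋ᶠ_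

  _≋ᶠ_ : {X : Pred (Point d) 0ℓ} → Rel (Facet X) 0ℓ
  F ≋ᶠ G = Facet.face F ≋ Facet.face G

  Adjacent : {X : Pred (Point d) 0ℓ} → Rel (Facet X) 0ℓ
  Adjacent {d} {X} F G =
    ¬ F ≋ᶠ G ×
    Σ[ R ∈ Face X ] HasDim (Face.points R) (d ∸ 2) × R ⊑ Facet.face F × R ⊑ Facet.face G

  adj : {X : Pred (Point d) 0ℓ} → Facet X → Pred (Facet X) 0ℓ
  adj S F = Adjacent F S

  IsSimplexFacet : {X : Pred (Point d) 0ℓ} → Facet X → Set₁
  IsSimplexFacet {d} S =
    Σ[ Δ ∈ Pred (Point d) 0ℓ ]
      IsSimplex (d ∸ 1) Δ × CombinatoriallyEquivalent (Facet.points S) Δ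

  InBoundedPosition : {X : Pred (Point d) 0ℓ} → Facet X → Set
  InBoundedPosition {d} {X} S =
    (G : Vector (Facet X) d) → Injective _≡_ _≋ᶠ_ G → (∀ i → G i ∈ adj S) →
    ∃[ x ] x ∈ Facet.H⁻ S × (λ y → ∀ i → y ∈ Facet.H (G i)) ≐ singleton x

  IsNonsimple : {X : Pred (Point d) 0ℓ} → Facet X → Pred (Facet X) 0ℓ → Set
  IsNonsimple {d} {X} S 𝓕 =
    ¬ (Σ[ G ∈ Facet X ] Σ[ G′ ∈ Facet X ]
         G ∈ 𝓕 × G′ ∈ 𝓕 × Adjacent G G′ ×
         (Σ[ T ∈ Face X ] HasDim (Face.points T) (d ∸ 3) ×
            T ⊑ Facet.face G × T ⊑ Facet.face G′ × T ⊑ Facet.face S))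

  V : {X : Pred (Point d) 0ℓ} → Facet X → (𝓕 𝓝 : Pred (Facet X) 0ℓ) → Pred (Point d) 0ℓ
  V S 𝓕 𝓝 x =
    (∀ F → F ∈ 𝓝 ⊎ F ≋ᶠ S → x ∈ Facet.H⁻ F) ×
    (∀ F → F ∈ 𝓕 → x ∈ Facet.H F) ×
    (∀ F → F ∉ 𝓝 → ¬ F ≋ᶠ S → F ∉ 𝓕 → x ∈ Facet.H⁺ F)

{-# OPTIONS --safe #-}
module Submission where

-- A face G of conv (P ∪ {v}) that misses v is a face of P.  Otherwise G is the
-- convex hull of v and a face F of P.
--
-- If v ∉ aff F, then G is a pyramid over F, a face of dimension k - 1; F lies in
-- a k-face of P, which is a simplex, so F and G are simplices.
--
-- If v ∈ aff F, then dim F ≤ k ≤ d - 2, so F lies in a ridge of P and hence in two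
-- adjacent facets G₁, G₂.  Their hyperplanes contain v, so G₁, G₂ ∈ 𝓕 ⊆ adj S.
-- The ridges G₁ ∩ S and G₂ ∩ S are distinct, since no ridge lies on three facets,
-- and two facets of the simplex S meet in a (d-3)-face.  This contradicts the
-- assumption that 𝓕 is nonsimple.

open import Defs
open import Level using (0ℓ)
open import Data.Empty using (⊥-elim)
open import Data.Fin.Base using (Fin; zero; suc; punchIn; punchOut)
open import Data.Fin.Properties using (_≟_; punchInᵢ≢i; punchIn-punchOut; punchIn-injective)
open import Data.Nat.Base using (ℕ; zero; suc; z≤n; s≤s; s≤s⁻¹; _∸_) renaming (_≤_ to _≤ℕ_; _<_ to _<ℕ_; _+_ to _+ℕ_)
open import Data.Product.Base using (_×_; _,_; proj₁; proj₂; ∃-syntax; Σ-syntax)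
open import Data.Sum.Base using (_⊎_; inj₁; inj₂)
open import Data.Vec.Functional using (Vector; _∷_; head; tail; insertAt; removeAt)
open import Data.Vec.Functional.Properties using (insertAt-lookup; insertAt-punchIn)
open import Function.Base using (_∘_; id)
open import Relation.Binary.Definitions using (_Respects_)
open import Relation.Binary.Morphism.Structures using (IsOrderIsomorphism)
open import Relation.Binary.PropositionalEquality.Core as ≡ using (_≡_; _≢_)
open import Relation.Binary.Structures using (IsTotalOrder)
open import Relation.Nullary.Decidable using (Dec; yes; no)
open import Relation.Nullary.Negation using (¬_; contradiction)
open import Relation.Unary using (Pred; _∈_; _∉_; _⊆_; _≐_; _∪_; _⊥_)
import Algebra.Properties.Ring as RingProperties
import Algebra.Properties.Semiring.Sum as SemiringSum
import Algebra.Solver.Ring.NaturalCoefficients.Default as SemiringSolver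
import Data.Nat.Properties as ℕ
import Relation.Binary.Reasoning.Setoid as SetoidReasoning

-- Everything about polytopes is derived from two presentations: `P` as the hull of finitely many
-- generators, and a face as an inequality. Passing between them rests on one principle: a convex
-- combination that is tight for a valid inequality puts weight only on tight points. New faces come
-- from one construction, tilting a supporting hyperplane until it meets a further generator. This
-- yields strict inclusions but no dimensions, so dimensions are pinned down afterwards by counting
-- independent points. The facet `S` is compared with a simplex through an order isomorphism of
-- faces, which does not carry dimensions either. Inside `S` they are recovered from the order,
-- through the absence of intermediate faces. The two cases for v are kept apart: the pyramid
-- argument assumes that v avoids the affine hulls of all faces of dimension at most k, and the
-- signs prescribed by `V` supply this assumption.

-- Ordered fields: excluded middle, finite sums, extremal choices in finite families.

module OrderedField (𝓡 : CompleteOrderedField) where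

  open CompleteOrderedField 𝓡 hiding (zero) renaming (Carrier to ℝ)
  open IsTotalOrder isTotalOrder public
    using (antisym; total)
    renaming (reflexive to ≤-reflexive; trans to ≤-trans; ≲-respˡ-≈ to ≤-respˡ-≈; ≲-respʳ-≈ to ≤-respʳ-≈)
  open RingProperties ring public using (-‿involutive; -0#≈0#; -‿distribˡ-*; -‿distribʳ-*; +-cancelˡ)
  open SemiringSum semiring public
  open SetoidReasoning setoid public
  open SemiringSolver commutativeSemiring public using (solve; _:+_; _:*_; _:=_; con)

  private variable
    n : ℕ
    x y z : ℝ

  ≤-refl : x ≤ x
  ≤-refl = ≤-reflexive refl

  +-mono-≤ : ∀ {w x y z} → w ≤ x → y ≤ z → w + y ≤ x + z
  +-mono-≤ {w} {x} {y} {z} w≤x y≤z = ≤-trans (+-monoʳ-≤ w y≤z)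
    (≤-respˡ-≈ (+-comm z w) (≤-respʳ-≈ (+-comm z x) (+-monoʳ-≤ z w≤x)))

  +-nonNeg : 0# ≤ x → 0# ≤ y → 0# ≤ x + y
  +-nonNeg 0≤x 0≤y = ≤-respˡ-≈ (+-identityˡ 0#) (+-mono-≤ 0≤x 0≤y)

  nonPos⇒-nonNeg : x ≤ 0# → 0# ≤ - x
  nonPos⇒-nonNeg {x} x≤0 = ≤-respˡ-≈ (-‿inverseˡ x) (≤-respʳ-≈ (+-identityʳ (- x)) (+-monoʳ-≤ (- x) x≤0))

  nonNeg⇒-nonPos : 0# ≤ x → - x ≤ 0#
  nonNeg⇒-nonPos {x} 0≤x = ≤-respʳ-≈ (-‿inverseˡ x) (≤-respˡ-≈ (+-identityʳ (- x)) (+-monoʳ-≤ (- x) 0≤x))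

  0≤-⇒≤ : 0# ≤ y + - x → x ≤ y
  0≤-⇒≤ {y} {x} 0≤ = ≤-respˡ-≈ (+-identityʳ x) (≤-respʳ-≈ eq (+-monoʳ-≤ x 0≤))
    where
    eq : x + (y + - x) ≈ y
    eq = begin
      x + (y + - x) ≈⟨ solve 3 (λ x y m → x :+ (y :+ m) := y :+ (x :+ m)) refl x y (- x) ⟩
      y + (x + - x) ≈⟨ +-congˡ (-‿inverseʳ x) ⟩
      y + 0#        ≈⟨ +-identityʳ y ⟩
      y             ∎

  ≤⇒0≤- : x ≤ y → 0# ≤ y + - x
  ≤⇒0≤- {x} {y} x≤y = ≤-respˡ-≈ (-‿inverseˡ x) (≤-respʳ-≈ (+-comm (- x) y) (+-monoʳ-≤ (- x) x≤y))

  *-monoʳ-≤ : 0# ≤ z → x ≤ y → x * z ≤ y * z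
  *-monoʳ-≤ {z} {x} {y} 0≤z x≤y = 0≤-⇒≤ (≤-respʳ-≈ eq (*-nonNeg (≤⇒0≤- x≤y) 0≤z))
    where
    eq : (y + - x) * z ≈ y * z + - (x * z)
    eq = trans (distribʳ z y (- x)) (+-congˡ (sym (-‿distribˡ-* x z)))

  0≤1 : 0# ≤ 1#
  0≤1 with total 0# 1#
  ... | inj₁ 0≤1 = 0≤1
  ... | inj₂ 1≤0 = ≤-respʳ-≈ eq (*-nonNeg (nonPos⇒-nonNeg 1≤0) (nonPos⇒-nonNeg 1≤0))
    where
    eq : - 1# * - 1# ≈ 1#
    eq = begin
      - 1# * - 1#   ≈⟨ -‿distribˡ-* 1# (- 1#) ⟨
      - (1# * - 1#) ≈⟨ -‿cong (*-identityˡ (- 1#)) ⟩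
      - (- 1#)      ≈⟨ -‿involutive 1# ⟩
      1#            ∎

  1≰0 : ¬ 1# ≤ 0#
  1≰0 1≤0 = 0≉1 (antisym 0≤1 1≤0)

  -1≤0 : - 1# ≤ 0#
  -1≤0 = nonNeg⇒-nonPos 0≤1

  -1≱0 : ¬ 0# ≤ - 1#
  -1≱0 0≤-1 = 1≰0 (≤-respˡ-≈ (-‿involutive 1#) (nonNeg⇒-nonPos 0≤-1))

  abstract
    -- The supremum of {-1} ∪ {1 ∣ A} is positive or not according to A.
    em : (A : Set) → Dec A
    em A with supremum D (- 1# , inj₁ refl) (1# , bound)
      where
      D : Pred ℝ 0ℓ
      D x = x ≈ - 1# ⊎ (x ≈ 1# × A)

      bound : ∀ {a} → D a → a ≤ 1#
      bound (inj₁ a≈-1)      = ≤-respˡ-≈ (sym a≈-1) (≤-trans -1≤0 0≤1)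
      bound (inj₂ (a≈1 , _)) = ≤-reflexive a≈1
    ... | s , upper , approx with total 0# s
    ...   | inj₂ s≤0 = no λ a → 1≰0 (≤-trans (upper (inj₂ (refl , a))) s≤0)
    ...   | inj₁ 0≤s with approx (≤-trans -1≤0 0≤s , λ -1≈s → -1≱0 (≤-respʳ-≈ (sym -1≈s) 0≤s))
    ...     | _ , inj₁ a≈-1 , _ , -1≉a = contradiction (sym a≈-1) -1≉a
    ...     | _ , inj₂ (_ , a) , _     = yes a

  by-contradiction : {A : Set} → ¬ ¬ A → A
  by-contradiction {A} ¬¬a with em A
  ... | yes a = a
  ... | no ¬a = contradiction ¬a ¬¬a

  *-integral : ¬ x ≈ 0# → x * y ≈ 0# → y ≈ 0#
  *-integral {x} {y} x≉0 xy≈0 with inverse x x≉0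
  ... | x⁻¹ , xx⁻¹≈1 = begin
    y               ≈⟨ *-identityˡ y ⟨
    1# * y          ≈⟨ *-congʳ xx⁻¹≈1 ⟨
    (x * x⁻¹) * y   ≈⟨ solve 3 (λ x i y → (x :* i) :* y := i :* (x :* y)) refl x x⁻¹ y ⟩
    x⁻¹ * (x * y)   ≈⟨ *-congˡ xy≈0 ⟩
    x⁻¹ * 0#        ≈⟨ zeroʳ x⁻¹ ⟩
    0#              ∎

  -- Eliminations divide by -x rather than by x, so that they stay semiring
  -- identities.
  negInverse : ∀ x → ¬ x ≈ 0# → ∃[ y ] 1# + y * x ≈ 0#
  negInverse x x≉0 with inverse x x≉0
  ... | x⁻¹ , xx⁻¹≈1 = - x⁻¹ , (begin
    1# + - x⁻¹ * x    ≈⟨ +-congˡ (-‿distribˡ-* x⁻¹ x) ⟨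
    1# + - (x⁻¹ * x)  ≈⟨ +-congˡ (-‿cong (trans (*-comm x⁻¹ x) xx⁻¹≈1)) ⟩
    1# + - 1#         ≈⟨ -‿inverseʳ 1# ⟩
    0#                ∎)

  cancel-negInverse : ∀ a {x y} → 1# + y * x ≈ 0# → a + (a * y) * x ≈ 0#
  cancel-negInverse a {x} {y} eq = begin
    a + (a * y) * x   ≈⟨ solve 3 (λ a x y → a :+ (a :* y) :* x := a :* (con 1 :+ y :* x)) refl a x y ⟩
    a * (1# + y * x)  ≈⟨ *-congˡ eq ⟩
    a * 0#            ≈⟨ zeroʳ a ⟩
    0#                ∎

  0≤⇒inverse-0≤ : 0# ≤ x → x * y ≈ 1# → 0# ≤ y
  0≤⇒inverse-0≤ {x} {y} 0≤x xy≈1 with total 0# y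
  ... | inj₁ 0≤y = 0≤y
  ... | inj₂ y≤0 = contradiction
    (≤-respˡ-≈ (trans (-‿cong (trans (sym (-‿distribʳ-* x y)) (-‿cong xy≈1))) (-‿involutive 1#))
      (nonNeg⇒-nonPos (*-nonNeg 0≤x (nonPos⇒-nonNeg y≤0))))
    1≰0

  sum-zero : (t : Vector ℝ n) → (∀ i → t i ≈ 0#) → sum t ≈ 0#
  sum-zero {n} t t≈0 = trans (sum-cong-≋ t≈0) (sum-replicate-zero n)

  sum-single : (t : Vector ℝ n) (i : Fin n) → (∀ j → j ≢ i → t j ≈ 0#) → sum t ≈ t i
  sum-single {suc n} t i t≈0 = begin
    sum t                      ≈⟨ sum-remove t ⟩
    t i + sum (removeAt t i)   ≈⟨ +-congˡ (sum-zero (removeAt t i) λ j → t≈0 _ (punchInᵢ≢i i j)) ⟩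
    t i + 0#                   ≈⟨ +-identityʳ (t i) ⟩
    t i                        ∎

  sum-nonNeg : (t : Vector ℝ n) → (∀ i → 0# ≤ t i) → 0# ≤ sum t
  sum-nonNeg {zero}  t 0≤t = ≤-refl
  sum-nonNeg {suc n} t 0≤t = +-nonNeg (0≤t zero) (sum-nonNeg (tail t) (0≤t ∘ suc))

  sum-nonPos : (t : Vector ℝ n) → (∀ i → t i ≤ 0#) → sum t ≤ 0#
  sum-nonPos {zero}  t t≤0 = ≤-refl
  sum-nonPos {suc n} t t≤0 = ≤-respʳ-≈ (+-identityˡ 0#) (+-mono-≤ (t≤0 zero) (sum-nonPos (tail t) (t≤0 ∘ suc)))

  sum-nonNeg-zero : (t : Vector ℝ n) → (∀ i → 0# ≤ t i) → sum t ≈ 0# → ∀ i → t i ≈ 0#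
  sum-nonNeg-zero {suc n} t 0≤t Σ≈0 i = antisym (≤-respʳ-≈ Σ≈0 ti≤Σ) (0≤t i)
    where
    ti≤Σ : t i ≤ sum t
    ti≤Σ = ≤-respˡ-≈ (+-identityʳ (t i)) (≤-respʳ-≈ (sym (sum-remove t))
      (+-monoʳ-≤ (t i) (sum-nonNeg (removeAt t i) (λ j → 0≤t (punchIn i j)))))

  argmin : (r : Vector ℝ n) (C : Pred (Fin n) 0ℓ) → ∃[ i ] C i → ∃[ i ] C i × (∀ j → C j → r i ≤ r j)
  argmin {suc n} r C (i₀ , Ci₀) with em (∃[ i ] C (suc i))
  ... | no ∄ = zero , C0 i₀ Ci₀ , λ { zero _ → ≤-refl ; (suc j) Cj → contradiction (j , Cj) ∄ }
    where
    C0 : ∀ i → C i → C zero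
    C0 zero    Ci = Ci
    C0 (suc i) Ci = contradiction (i , Ci) ∄
  ... | yes ∃C with argmin (tail r) (C ∘ suc) ∃C | em (C zero)
  ...   | i , Ci , min | no ¬C0 = suc i , Ci , λ { zero C0 → contradiction C0 ¬C0 ; (suc j) → min j }
  ...   | i , Ci , min | yes C0 with total (r zero) (r (suc i))
  ...     | inj₁ r₀≤ = zero  , C0 , λ { zero _ → ≤-refl ; (suc j) Cj → ≤-trans r₀≤ (min j Cj) }
  ...     | inj₂ r₀≥ = suc i , Ci , λ { zero _ → r₀≥ ; (suc j) → min j }

  upperBound : (r : Vector ℝ n) → ∃[ s ] (∀ i → r i ≤ s)
  upperBound {zero}  r = 0# , λ ()
  upperBound {suc n} r with upperBound (tail r)
  ... | s , r≤s with total (r zero) s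
  ...   | inj₁ r₀≤s = s , λ { zero → r₀≤s ; (suc i) → r≤s i }
  ...   | inj₂ s≤r₀ = r zero , λ { zero → ≤-refl ; (suc i) → ≤-trans (r≤s i) s≤r₀ }

  -- Truncated to 0 at 0.
  infix 8 _⁻¹
  _⁻¹ : ℝ → ℝ
  x ⁻¹ with em (x ≈ 0#)
  ... | yes _  = 0#
  ... | no x≉0 = proj₁ (inverse x x≉0)

  ⁻¹-inverse : ¬ x ≈ 0# → x * x ⁻¹ ≈ 1#
  ⁻¹-inverse {x} x≉0 with em (x ≈ 0#)
  ... | yes x≈0 = contradiction x≈0 x≉0
  ... | no x≉0′ = proj₂ (inverse x x≉0′)

  x*y⁻¹*y : ∀ x → ¬ y ≈ 0# → (x * y ⁻¹) * y ≈ x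
  x*y⁻¹*y {y} x y≉0 = begin
    (x * y ⁻¹) * y ≈⟨ *-assoc x (y ⁻¹) y ⟩
    x * (y ⁻¹ * y) ≈⟨ *-congˡ (trans (*-comm (y ⁻¹) y) (⁻¹-inverse y≉0)) ⟩
    x * 1#         ≈⟨ *-identityʳ x ⟩
    x              ∎

  nonNeg-cancel : 0# ≤ y → ¬ y ≈ 0# → 0# ≤ x * y → 0# ≤ x
  nonNeg-cancel {y} {x} 0≤y y≉0 0≤xy = ≤-respʳ-≈ eq (*-nonNeg 0≤xy (0≤⇒inverse-0≤ 0≤y (⁻¹-inverse y≉0)))
    where
    eq : x * y * y ⁻¹ ≈ x
    eq = trans (*-assoc x y (y ⁻¹)) (trans (*-congˡ (⁻¹-inverse y≉0)) (*-identityʳ x))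

  -- The ratio test of the simplex method: `t` is the least quotient of `a i` by `g i` over the
  -- indices in `C` with `g i` positive, so the first decreasing entry to reach 0 is the tight one.
  -- Since `t` is nonnegative, entries with `g i` at most 0 do not decrease.
  ratioTest : (a g : Vector ℝ n) (C : Pred (Fin n) 0ℓ) → (∀ i → 0# ≤ a i) →
              ∃[ i ] C i × 0# < g i →
              ∃[ t ] (∀ i → C i → 0# ≤ a i + - t * g i)
                   × ∃[ i ] C i × 0# < g i × a i + - t * g i ≈ 0#
  ratioTest {n} a g C 0≤a ∃g>0 = t , feasible , i , proj₁ Ci , proj₂ Ci , tight
    where
    r : Vector ℝ n
    r i = a i * g i ⁻¹

    min = argmin r (λ i → C i × 0# < g i) ∃g>0
    i   = proj₁ min
    Ci  = proj₁ (proj₂ min)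
    t   = r i

    0≤t : 0# ≤ t
    0≤t = *-nonNeg (0≤a i) (0≤⇒inverse-0≤ (proj₁ (proj₂ Ci)) (⁻¹-inverse (proj₂ (proj₂ Ci) ∘ sym)))

    tight : a i + - t * g i ≈ 0#
    tight = begin
      a i + - t * g i   ≈⟨ +-congˡ (-‿distribˡ-* t (g i)) ⟨
      a i + - (t * g i) ≈⟨ +-congˡ (-‿cong (x*y⁻¹*y (a i) (proj₂ (proj₂ Ci) ∘ sym))) ⟩
      a i + - a i       ≈⟨ -‿inverseʳ (a i) ⟩
      0#                ∎

    feasible : ∀ j → C j → 0# ≤ a j + - t * g j
    feasible j Cj with em (0# < g j)
    ... | yes 0<g = ≤-respʳ-≈ (+-congˡ (-‿distribˡ-* t (g j)))
            (≤⇒0≤- (≤-respʳ-≈ (x*y⁻¹*y (a j) (proj₂ 0<g ∘ sym))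
              (*-monoʳ-≤ (proj₁ 0<g) (proj₂ (proj₂ min) j (Cj , 0<g)))))
    ... | no 0≮g with total (g j) 0#
    ...   | inj₁ g≤0 = +-nonNeg (0≤a j) (≤-respʳ-≈ (trans (sym (-‿distribʳ-* t (g j))) (-‿distribˡ-* t (g j)))
                         (*-nonNeg 0≤t (nonPos⇒-nonNeg g≤0)))
    ...   | inj₂ 0≤g with em (0# ≈ g j)
    ...     | no 0≉g  = contradiction (0≤g , 0≉g) 0≮g
    ...     | yes 0≈g = +-nonNeg (0≤a j) (≤-reflexive (sym (trans (*-congˡ (sym 0≈g)) (zeroʳ (- t)))))

  bigMultiple : (b c : Vector ℝ n) → (∀ i → 0# ≤ b i) →
                ∃[ s ] (∀ i → ¬ b i ≈ 0# → 0# < c i + s * b i)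
  -- The 1 in the numerator is a margin that makes the conclusion strict. Indices with `b i` equal
  -- to 0 contribute the harmless value 0, by the truncated inverse.
  bigMultiple {n} b c 0≤b with upperBound {n} (λ i → (1# + - c i) * b i ⁻¹)
  ... | s , r≤s = s , λ i bi≉0 → let 1≤ = 1≤c+sb i bi≉0 in
        ≤-trans 0≤1 1≤ , λ 0≈ → 1≰0 (≤-respʳ-≈ (sym 0≈) 1≤)
    where
    1≤c+sb : ∀ i → ¬ b i ≈ 0# → 1# ≤ c i + s * b i
    1≤c+sb i bi≉0 = ≤-respˡ-≈ eq (+-monoʳ-≤ (c i)
      (≤-respˡ-≈ (x*y⁻¹*y (1# + - c i) bi≉0) (*-monoʳ-≤ (0≤b i) (r≤s i))))
      where
      eq : c i + (1# + - c i) ≈ 1#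
      eq = begin
        c i + (1# + - c i) ≈⟨ solve 3 (λ c o m → c :+ (o :+ m) := o :+ (c :+ m)) refl (c i) 1# (- c i) ⟩
        1# + (c i + - c i) ≈⟨ +-congˡ (-‿inverseʳ (c i)) ⟩
        1# + 0#            ≈⟨ +-identityʳ 1# ⟩
        1#                 ∎

-- Linear algebra: spans, cones, the Steinitz bound, separating functionals.

module LinearAlgebra (𝓡 : CompleteOrderedField) where

  open CompleteOrderedField 𝓡 hiding (zero) renaming (Carrier to ℝ)
  open OrderedField 𝓡
  open Geometry 𝓡

  private variable
    d m n : ℕ

  ⟨⟩-congˡ : {x y : Point d} (f : Point d) → x ≈ᵖ y → ⟨ x , f ⟩ ≈ ⟨ y , f ⟩
  ⟨⟩-congˡ f x≈y = sum-cong-≋ λ i → *-congʳ (x≈y i)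

  ⟨⟩-comm : (x f : Point d) → ⟨ x , f ⟩ ≈ ⟨ f , x ⟩
  ⟨⟩-comm x f = sum-cong-≋ λ i → *-comm (x i) (f i)

  ⟨⟩-combination : (c : Vector ℝ n) (p : Vector (Point d) n) (f : Point d) →
                   ⟨ combination c p , f ⟩ ≈ sum λ i → c i * ⟨ p i , f ⟩
  ⟨⟩-combination c p f = begin
    sum (λ j → sum (λ i → c i * p i j) * f j)   ≈⟨ sum-cong-≋ (λ j → *-distribʳ-sum (f j) (λ i → c i * p i j)) ⟩
    sum (λ j → sum (λ i → c i * p i j * f j))   ≈⟨ ∑-comm (λ j i → c i * p i j * f j) ⟩
    sum (λ i → sum (λ j → c i * p i j * f j))   ≈⟨ sum-cong-≋ (λ i → sum-cong-≋ λ j → *-assoc (c i) (p i j) (f j)) ⟩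
    sum (λ i → sum (λ j → c i * (p i j * f j))) ≈⟨ sum-cong-≋ (λ i → *-distribˡ-sum (c i) (λ j → p i j * f j)) ⟨
    sum (λ i → c i * ⟨ p i , f ⟩)               ∎

  infixl 6 _+[_]_
  _+[_]_ : Point d → ℝ → Point d → Point d
  (x +[ r ] y) i = x i + r * y i

  ⟨⟩-+[]ˡ : (x : Point d) (r : ℝ) (y f : Point d) → ⟨ x +[ r ] y , f ⟩ ≈ ⟨ x , f ⟩ + r * ⟨ y , f ⟩
  ⟨⟩-+[]ˡ x r y f = begin
    sum (λ i → (x i + r * y i) * f i)            ≈⟨ sum-cong-≋ (λ i → solve 4 (λ x r y f → (x :+ r :* y) :* f := x :* f :+ r :* (y :* f)) refl (x i) r (y i) (f i)) ⟩
    sum (λ i → x i * f i + r * (y i * f i))      ≈⟨ ∑-distrib-+ (λ i → x i * f i) (λ i → r * (y i * f i)) ⟩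
    ⟨ x , f ⟩ + sum (λ i → r * (y i * f i))      ≈⟨ +-congˡ (*-distribˡ-sum r (λ i → y i * f i)) ⟨
    ⟨ x , f ⟩ + r * ⟨ y , f ⟩                    ∎

  ⟨⟩-+[]ʳ : (x f : Point d) (r : ℝ) (g : Point d) → ⟨ x , f +[ r ] g ⟩ ≈ ⟨ x , f ⟩ + r * ⟨ x , g ⟩
  ⟨⟩-+[]ʳ x f r g = begin
    ⟨ x , f +[ r ] g ⟩        ≈⟨ ⟨⟩-comm x (f +[ r ] g) ⟩
    ⟨ f +[ r ] g , x ⟩        ≈⟨ ⟨⟩-+[]ˡ f r g x ⟩
    ⟨ f , x ⟩ + r * ⟨ g , x ⟩ ≈⟨ +-cong (⟨⟩-comm f x) (*-congˡ (⟨⟩-comm g x)) ⟩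
    ⟨ x , f ⟩ + r * ⟨ x , g ⟩ ∎

  combination-insertAt : (c : Vector ℝ n) (i : Fin (suc n)) (a : ℝ) (w : Vector (Point d) (suc n)) →
                         combination (insertAt c i a) w ≈ᵖ combination c (removeAt w i) +[ a ] w i
  combination-insertAt c i a w j = begin
    combination (insertAt c i a) w j                     ≈⟨ sum-remove {i = i} (λ l → insertAt c i a l * w l j) ⟩
    insertAt c i a i * w i j + sum (λ l → insertAt c i a (punchIn i l) * removeAt w i l j)
      ≈⟨ +-cong (*-congʳ (reflexive (insertAt-lookup c i a)))
                (sum-cong-≋ λ l → *-congʳ (reflexive (insertAt-punchIn c i a l))) ⟩
    a * w i j + combination c (removeAt w i) j           ≈⟨ +-comm _ _ ⟩
    combination c (removeAt w i) j + a * w i j           ∎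

  indicator : Fin n → Vector ℝ n
  indicator i j with j ≟ i
  ... | yes _ = 1#
  ... | no  _ = 0#

  indicator-nonNeg : (i j : Fin n) → 0# ≤ indicator i j
  indicator-nonNeg i j with j ≟ i
  ... | yes _ = 0≤1
  ... | no  _ = ≤-refl

  indicator-self : (i : Fin n) → indicator i i ≈ 1#
  indicator-self i with i ≟ i
  ... | yes _  = refl
  ... | no i≢i = contradiction ≡.refl i≢i

  indicator-other : (i j : Fin n) → j ≢ i → indicator i j ≈ 0#
  indicator-other i j j≢i with j ≟ i
  ... | yes j≡i = contradiction j≡i j≢i
  ... | no _    = refl

  combination-indicator : (i : Fin n) (w : Vector (Point d) n) → combination (indicator i) w ≈ᵖ w i
  combination-indicator i w j = begin
    sum (λ l → indicator i l * w l j) ≈⟨ sum-single _ i (λ l l≢i → trans (*-congʳ (indicator-other i l l≢i)) (zeroˡ (w l j))) ⟩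
    indicator i i * w i j             ≈⟨ *-congʳ (indicator-self i) ⟩
    1# * w i j                        ≈⟨ *-identityˡ (w i j) ⟩
    w i j                             ∎

  Span Cone : Vector (Point d) n → Pred (Point d) 0ℓ
  Span w x = ∃[ c ] x ≈ᵖ combination c w
  Cone w x = ∃[ c ] (∀ i → 0# ≤ c i) × x ≈ᵖ combination c w

  LinearlyIndependent : Vector (Point d) n → Set
  LinearlyIndependent {d} {n} w = (c : Vector ℝ n) → combination c w ≈ᵖ (λ _ → 0#) → ∀ i → c i ≈ 0#

  combination-congʳ : (c : Vector ℝ n) {v w : Vector (Point d) n} → (∀ i → v i ≈ᵖ w i) → combination c v ≈ᵖ combination c w
  combination-congʳ c v≈w j = sum-cong-≋ λ i → *-congˡ (v≈w i j)

  combination-combination : (e : Vector ℝ m) (c : Vector (Vector ℝ n) m) (w : Vector (Point d) n) →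
                            combination e (λ i → combination (c i) w) ≈ᵖ combination (combination e c) w
  combination-combination e c w j = sym (⟨⟩-combination e c (λ l → w l j))

  span-resp-≈ᵖ : {w : Vector (Point d) n} {x y : Point d} → x ≈ᵖ y → Span w y → Span w x
  span-resp-≈ᵖ x≈y (c , y≈) = c , λ j → trans (x≈y j) (y≈ j)

  span-member : (w : Vector (Point d) n) (i : Fin n) → Span w (w i)
  span-member w i = indicator i , λ j → sym (combination-indicator i w j)

  span-combination : {w : Vector (Point d) n} (e : Vector ℝ m) {q : Vector (Point d) m} →
                     (∀ i → Span w (q i)) → Span w (combination e q)
  span-combination {w = w} e q∈ = combination e (proj₁ ∘ q∈) , λ j →
    trans (combination-congʳ e (proj₂ ∘ q∈) j) (combination-combination e (proj₁ ∘ q∈) w j)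

  span-trans : {w : Vector (Point d) n} {q : Vector (Point d) m} {x : Point d} →
               (∀ i → Span w (q i)) → Span q x → Span w x
  span-trans q∈ (e , x≈) = span-resp-≈ᵖ x≈ (span-combination e q∈)

  cone-member : (w : Vector (Point d) n) (i : Fin n) → Cone w (w i)
  cone-member w i = indicator i , indicator-nonNeg i , λ j → sym (combination-indicator i w j)

  cone-combination : {w : Vector (Point d) n} (e : Vector ℝ m) {q : Vector (Point d) m} →
                     (∀ i → 0# ≤ e i) → (∀ i → Cone w (q i)) → Cone w (combination e q)
  cone-combination {w = w} e 0≤e q∈ = combination e (proj₁ ∘ q∈) ,
    (λ l → sum-nonNeg _ λ i → *-nonNeg (0≤e i) (proj₁ (proj₂ (q∈ i)) l)) , λ j →
    trans (combination-congʳ e (λ i → proj₂ (proj₂ (q∈ i))) j) (combination-combination e (proj₁ ∘ q∈) w j)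

  span-annihilated : {w : Vector (Point d) n} {x : Point d} (f : Point d) →
                     (∀ i → ⟨ w i , f ⟩ ≈ 0#) → Span w x → ⟨ x , f ⟩ ≈ 0#
  span-annihilated {w = w} {x} f w⊥f (c , x≈) = begin
    ⟨ x , f ⟩                       ≈⟨ ⟨⟩-congˡ f x≈ ⟩
    ⟨ combination c w , f ⟩         ≈⟨ ⟨⟩-combination c w f ⟩
    sum (λ i → c i * ⟨ w i , f ⟩)   ≈⟨ sum-zero _ (λ i → trans (*-congˡ (w⊥f i)) (zeroʳ (c i))) ⟩
    0#                              ∎

  independent-∷ : {u : Point d} {w : Vector (Point d) n} →
                  LinearlyIndependent w → ¬ Span w u → LinearlyIndependent (u ∷ w)
  independent-∷ {u = u} {w} indep u∉ c c≈0 = λ { zero → c₀≈0 ; (suc i) → rest i }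
    where
    c₀≈0 : c zero ≈ 0#
    c₀≈0 with em (c zero ≈ 0#)
    ... | yes c₀≈0 = c₀≈0
    ... | no  c₀≉0 with negInverse (c zero) c₀≉0
    ...   | y , 1+yc₀≈0 = contradiction ((λ i → y * c (suc i)) , solved) u∉
      where
      solved : u ≈ᵖ combination (λ i → y * c (suc i)) w
      solved j = sym (begin
        sum (λ i → y * c (suc i) * w i j)     ≈⟨ sum-cong-≋ (λ i → *-assoc y (c (suc i)) (w i j)) ⟩
        sum (λ i → y * (c (suc i) * w i j))   ≈⟨ *-distribˡ-sum y (λ i → c (suc i) * w i j) ⟨
        y * A                                 ≈⟨ +-identityʳ (y * A) ⟨
        y * A + 0#                            ≈⟨ +-congˡ (cancel-negInverse (u j) 1+yc₀≈0) ⟨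
        y * A + (u j + u j * y * c zero)      ≈⟨ solve 4 (λ y A u c → y :* A :+ (u :+ u :* y :* c) := u :+ y :* (c :* u :+ A)) refl y A (u j) (c zero) ⟩
        u j + y * (c zero * u j + A)          ≈⟨ +-congˡ (*-congˡ (c≈0 j)) ⟩
        u j + y * 0#                          ≈⟨ +-congˡ (zeroʳ y) ⟩
        u j + 0#                              ≈⟨ +-identityʳ (u j) ⟩
        u j                                   ∎)
        where A = combination (tail c) w j

    rest : ∀ i → c (suc i) ≈ 0#
    rest = indep (tail c) λ j → begin
      combination (tail c) w j                   ≈⟨ +-identityˡ _ ⟨
      0# + combination (tail c) w j              ≈⟨ +-congʳ (trans (*-congʳ c₀≈0) (zeroˡ (u j))) ⟨
      c zero * u j + combination (tail c) w j    ≈⟨ c≈0 j ⟩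
      0#                                         ∎

  independent-removeAt : (w : Vector (Point d) (suc n)) (i : Fin (suc n)) →
                         LinearlyIndependent w → LinearlyIndependent (removeAt w i)
  independent-removeAt w i indep c c≈0 l = trans (sym (reflexive (insertAt-punchIn c i 0# l)))
    (indep (insertAt c i 0#) (λ j → trans (combination-insertAt c i 0# w j)
      (trans (+-cong (c≈0 j) (zeroˡ (w i j))) (+-identityʳ 0#))) (punchIn i l))

  independent⇒∉span-removeAt : (w : Vector (Point d) (suc n)) (i : Fin (suc n)) →
                               LinearlyIndependent w → ¬ Span (removeAt w i) (w i)
  independent⇒∉span-removeAt w i indep (c , wi≈) = 0≉1 (begin
    0#           ≈⟨ -0#≈0# ⟨
    - 0#         ≈⟨ -‿cong (indep (insertAt c i (- 1#)) vanishes i) ⟨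
    - insertAt c i (- 1#) i ≈⟨ -‿cong (reflexive (insertAt-lookup c i (- 1#))) ⟩
    - (- 1#)     ≈⟨ -‿involutive 1# ⟩
    1#           ∎)
    where
    vanishes : combination (insertAt c i (- 1#)) w ≈ᵖ (λ _ → 0#)
    vanishes j = begin
      combination (insertAt c i (- 1#)) w j            ≈⟨ combination-insertAt c i (- 1#) w j ⟩
      combination c (removeAt w i) j + - 1# * w i j    ≈⟨ +-cong (wi≈ j) (-‿distribˡ-* 1# (w i j)) ⟨
      w i j + - (1# * w i j)                           ≈⟨ +-congˡ (-‿cong (*-identityˡ (w i j))) ⟩
      w i j + - w i j                                  ≈⟨ -‿inverseʳ (w i j) ⟩
      0#                                               ∎

  opaque
    steinitz : (u : Vector (Point d) m) (w : Vector (Point d) n) →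
               LinearlyIndependent u → (∀ j → Span w (u j)) → m ≤ℕ n
    steinitz {m = zero} u w indep u∈ = z≤n
    steinitz {m = suc m} {n = zero} u w indep u∈ = contradiction
      (trans (sym (indep (indicator zero) (λ j → trans (combination-indicator zero u j) (proj₂ (u∈ zero) j)) zero))
             (indicator-self {suc m} zero))
      0≉1
    steinitz {d} {suc m} {suc n} u w indep u∈ with em (∃[ i ] ¬ proj₁ (u∈ i) zero ≈ 0#)
    ... | no ∄ = ℕ.m≤n⇒m≤1+n (steinitz u (tail w) indep λ j → tail (proj₁ (u∈ j)) , λ l → begin
            u j l                                           ≈⟨ proj₂ (u∈ j) l ⟩
            proj₁ (u∈ j) zero * w zero l + combination (tail (proj₁ (u∈ j))) (tail w) l
              ≈⟨ +-congʳ (trans (*-congʳ (by-contradiction λ ≉0 → ∄ (j , ≉0))) (zeroˡ (w zero l))) ⟩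
            0# + combination (tail (proj₁ (u∈ j))) (tail w) l  ≈⟨ +-identityˡ _ ⟩
            combination (tail (proj₁ (u∈ j))) (tail w) l       ∎)
    ... | yes (i , αi≉0) with negInverse (proj₁ (u∈ i) zero) αi≉0
    ...   | y , 1+yαi≈0 = s≤s (steinitz u′ (tail w) indep′ u′∈)
      where
      α : Fin (suc m) → Vector ℝ (suc n)
      α j = proj₁ (u∈ j)

      -- As `y` is minus the inverse of the pivot coefficient, adding `r l` times the pivot row
      -- cancels the coefficient of `w zero`.
      r : Vector ℝ m
      r l = α (punchIn i l) zero * y

      u′ : Vector (Point d) m
      u′ l = u (punchIn i l) +[ r l ] u i

      u′∈ : ∀ l → Span (tail w) (u′ l)
      u′∈ l = tail β , λ j → begin
        u (punchIn i l) j + r l * u i j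
          ≈⟨ +-cong (proj₂ (u∈ (punchIn i l)) j) (*-congˡ (proj₂ (u∈ i) j)) ⟩
        ⟨ α (punchIn i l) , (λ t → w t j) ⟩ + r l * ⟨ α i , (λ t → w t j) ⟩
          ≈⟨ ⟨⟩-+[]ˡ (α (punchIn i l)) (r l) (α i) (λ t → w t j) ⟨
        β zero * w zero j + combination (tail β) (tail w) j
          ≈⟨ +-congʳ (trans (*-congʳ (cancel-negInverse (α (punchIn i l) zero) 1+yαi≈0)) (zeroˡ (w zero j))) ⟩
        0# + combination (tail β) (tail w) j
          ≈⟨ +-identityˡ _ ⟩
        combination (tail β) (tail w) j ∎
        where
        β : Vector ℝ (suc n)
        β = α (punchIn i l) +[ r l ] α i

      indep′ : LinearlyIndependent u′
      indep′ c c≈0 l = trans (sym (reflexive (insertAt-punchIn c i s l)))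
        (indep (insertAt c i s) vanishes (punchIn i l))
        where
        -- The total weight that a relation among the `u′ l` puts on the pivot `u i`; with it the
        -- relation becomes one among the original vectors.
        s : ℝ
        s = sum λ l → c l * r l

        vanishes : combination (insertAt c i s) u ≈ᵖ (λ _ → 0#)
        vanishes j = begin
          combination (insertAt c i s) u j                ≈⟨ combination-insertAt c i s u j ⟩
          combination c (removeAt u i) j + s * u i j      ≈⟨ +-congˡ (*-distribʳ-sum (u i j) (λ l → c l * r l)) ⟩
          combination c (removeAt u i) j + sum (λ l → c l * r l * u i j)
            ≈⟨ ∑-distrib-+ (λ l → c l * u (punchIn i l) j) (λ l → c l * r l * u i j) ⟨
          sum (λ l → c l * u (punchIn i l) j + c l * r l * u i j)
            ≈⟨ sum-cong-≋ (λ l → solve 4 (λ c u r v → c :* u :+ c :* r :* v := c :* (u :+ r :* v)) refl (c l) (u (punchIn i l) j) (r l) (u i j)) ⟩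
          combination c u′ j                              ≈⟨ c≈0 j ⟩
          0#                                              ∎

  -- Induction on the family. If the functional `f` for the tail does not already kill `w zero`,
  -- then u is moved along `w zero` into the kernel of `f`, a second functional `g` is found for the
  -- moved point, and `g` is corrected by a multiple of `f`.
  separate : (w : Vector (Point d) n) (u : Point d) → ¬ Span w u →
             ∃[ f ] (∀ i → ⟨ w i , f ⟩ ≈ 0#) × ¬ ⟨ u , f ⟩ ≈ 0#
  separate {n = zero} w u u∉ with em (∃[ j ] ¬ u j ≈ 0#)
  ... | yes (j , uj≉0) = indicator j , (λ ()) , λ ≈0 → uj≉0 (trans (sym (trans (⟨⟩-comm u (indicator j)) (coordinate j))) ≈0)
    where
    coordinate : ∀ j → ⟨ indicator j , u ⟩ ≈ u j
    coordinate j = combination-indicator {d = 1} j (λ l _ → u l) zero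
  ... | no ∄ = contradiction ((λ ()) , λ j → by-contradiction λ uj≉0 → ∄ (j , uj≉0)) u∉
  separate {n = suc n} w u u∉ with separate (tail w) u (u∉ ∘ weaken)
    where
    weaken : Span (tail w) u → Span w u
    weaken = span-trans {w = w} {q = tail w} λ i → span-member w (suc i)
  ... | f , w⊥f , u⊥̸f with em (⟨ w zero , f ⟩ ≈ 0#)
  ...   | yes w₀⊥f = f , (λ { zero → w₀⊥f ; (suc i) → w⊥f i }) , u⊥̸f
  ...   | no  w₀⊥̸f with negInverse ⟨ w zero , f ⟩ w₀⊥̸f
  ...     | y , 1+y⟨w₀,f⟩≈0 with separate (tail w) (u +[ ⟨ u , f ⟩ * y ] w zero) u′∉
    where
    r = ⟨ u , f ⟩ * y

    u′∉ : ¬ Span (tail w) (u +[ r ] w zero)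
    u′∉ (c , ≈c) = u∉ (- r ∷ c , λ j → sym (begin
      - r * w zero j + combination c (tail w) j     ≈⟨ +-congˡ (≈c j) ⟨
      - r * w zero j + (u j + r * w zero j)         ≈⟨ solve 4 (λ m w u r → m :* w :+ (u :+ r :* w) := u :+ (m :+ r) :* w) refl (- r) (w zero j) (u j) r ⟩
      u j + (- r + r) * w zero j                    ≈⟨ +-congˡ (trans (*-congʳ (-‿inverseˡ r)) (zeroˡ (w zero j))) ⟩
      u j + 0#                                      ≈⟨ +-identityʳ (u j) ⟩
      u j                                           ∎))
  ...       | g , w⊥g , u′⊥̸g = g +[ s ] f , annihilates , λ ≈0 → u′⊥̸g (trans u′g≈uh ≈0)
    where
    -- This multiple makes the corrected functional vanish at `w zero`. Its value at u is then the
    -- value of `g` at the moved point, because shifting u and correcting `g` produce the same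
    -- product.
    s = ⟨ w zero , g ⟩ * y

    annihilates : ∀ i → ⟨ w i , g +[ s ] f ⟩ ≈ 0#
    annihilates zero    = trans (⟨⟩-+[]ʳ (w zero) g s f) (cancel-negInverse ⟨ w zero , g ⟩ 1+y⟨w₀,f⟩≈0)
    annihilates (suc i) = begin
      ⟨ w (suc i) , g +[ s ] f ⟩                    ≈⟨ ⟨⟩-+[]ʳ (w (suc i)) g s f ⟩
      ⟨ w (suc i) , g ⟩ + s * ⟨ w (suc i) , f ⟩     ≈⟨ +-cong (w⊥g i) (trans (*-congˡ (w⊥f i)) (zeroʳ s)) ⟩
      0# + 0#                                       ≈⟨ +-identityʳ 0# ⟩
      0#                                            ∎

    u′g≈uh : ⟨ u +[ ⟨ u , f ⟩ * y ] w zero , g ⟩ ≈ ⟨ u , g +[ s ] f ⟩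
    u′g≈uh = begin
      ⟨ u +[ ⟨ u , f ⟩ * y ] w zero , g ⟩           ≈⟨ ⟨⟩-+[]ˡ u (⟨ u , f ⟩ * y) (w zero) g ⟩
      ⟨ u , g ⟩ + ⟨ u , f ⟩ * y * ⟨ w zero , g ⟩    ≈⟨ solve 4 (λ a b c y → a :+ b :* y :* c := a :+ c :* y :* b) refl ⟨ u , g ⟩ ⟨ u , f ⟩ ⟨ w zero , g ⟩ y ⟩
      ⟨ u , g ⟩ + s * ⟨ u , f ⟩                     ≈⟨ ⟨⟩-+[]ʳ u g s f ⟨
      ⟨ u , g +[ s ] f ⟩                            ∎

  opaque
    separate⁺ : (w : Vector (Point d) n) (u : Point d) → ¬ Span w u →
                ∃[ f ] (∀ i → ⟨ w i , f ⟩ ≈ 0#) × 0# < ⟨ u , f ⟩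
    separate⁺ w u u∉ with separate w u u∉
    ... | f , w⊥f , u⊥̸f with total 0# ⟨ u , f ⟩
    ...   | inj₁ 0≤ = f , w⊥f , 0≤ , u⊥̸f ∘ sym
    ...   | inj₂ ≤0 = (λ i → - f i) , (λ i → trans (neg (w i)) (trans (-‿cong (w⊥f i)) -0#≈0#))
                    , ≤-respʳ-≈ (sym (neg u)) (nonPos⇒-nonNeg ≤0)
                    , λ 0≈ → u⊥̸f (trans (sym (-‿involutive _)) (trans (-‿cong (trans (sym (neg u)) (sym 0≈))) -0#≈0#))
      where
      neg : ∀ x → ⟨ x , (λ i → - f i) ⟩ ≈ - ⟨ x , f ⟩
      neg x = +-cancelˡ ⟨ x , f ⟩ _ _ (begin
        ⟨ x , f ⟩ + ⟨ x , (λ i → - f i) ⟩     ≈⟨ ∑-distrib-+ (λ i → x i * f i) (λ i → x i * - f i) ⟨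
        sum (λ i → x i * f i + x i * - f i)   ≈⟨ sum-zero _ (λ i → trans (sym (distribˡ (x i) (f i) (- f i))) (trans (*-congˡ (-‿inverseʳ (f i))) (zeroʳ (x i)))) ⟩
        0#                                    ≈⟨ -‿inverseʳ _ ⟨
        ⟨ x , f ⟩ + - ⟨ x , f ⟩               ∎)

-- Affine and convex hulls in homogeneous coordinates, faces as functionals, dimension.

module ConvexGeometry (𝓡 : CompleteOrderedField) where

  open CompleteOrderedField 𝓡 hiding (zero) renaming (Carrier to ℝ)
  open OrderedField 𝓡
  open LinearAlgebra 𝓡
  open Geometry 𝓡

  private variable
    d j k m n : ℕ

  -- Homogenisation: affine notions in dimension d are linear ones for hat.
  hat : Point d → Point (suc d)
  hat x = 1# ∷ x

  hat-cong : {x y : Point d} → x ≈ᵖ y → hat x ≈ᵖ hat y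
  hat-cong x≈y zero    = refl
  hat-cong x≈y (suc i) = x≈y i

  hat-combination-zero : (c : Vector ℝ n) (p : Vector (Point d) n) → combination c (hat ∘ p) zero ≈ sum c
  hat-combination-zero c p = sum-cong-≋ λ i → *-identityʳ (c i)

  hat-combination⁺ : (c : Vector ℝ n) (p : Vector (Point d) n) {x : Point d} →
                     sum c ≈ 1# → x ≈ᵖ combination c p → hat x ≈ᵖ combination c (hat ∘ p)
  hat-combination⁺ c p Σ≈1 x≈ zero    = trans (sym Σ≈1) (sym (hat-combination-zero c p))
  hat-combination⁺ c p Σ≈1 x≈ (suc j) = x≈ j

  hat-combination⁻ : (c : Vector ℝ n) (p : Vector (Point d) n) {x : Point d} →
                     hat x ≈ᵖ combination c (hat ∘ p) → sum c ≈ 1# × x ≈ᵖ combination c p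
  hat-combination⁻ c p eq = trans (sym (hat-combination-zero c p)) (sym (eq zero)) , eq ∘ suc

  affinely⇒linearly : (p : Vector (Point d) n) → AffinelyIndependent p → LinearlyIndependent (hat ∘ p)
  affinely⇒linearly p indep c c≈0 = indep c (trans (sym (hat-combination-zero c p)) (c≈0 zero)) (c≈0 ∘ suc)

  linearly⇒affinely : (p : Vector (Point d) n) → LinearlyIndependent (hat ∘ p) → AffinelyIndependent p
  linearly⇒affinely p indep c Σ≈0 c≈0 = indep c
    λ { zero → trans (hat-combination-zero c p) Σ≈0 ; (suc j) → c≈0 j }

  -- Unlike in `aff (range w)`, the coefficients refer to the family `w` itself, as elimination and
  -- counting require.
  Affine : Vector (Point d) n → Pred (Point d) 0ℓ
  Affine w x = Span (hat ∘ w) (hat x)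

  aff⇒affine : {w : Vector (Point d) n} → aff (range w) ⊆ Affine w
  aff⇒affine {w = w} (_ , q , c , q∈ , Σ≈1 , x≈) =
    span-resp-≈ᵖ {w = hat ∘ w} (hat-combination⁺ c q Σ≈1 x≈)
      (span-combination {w = hat ∘ w} c {hat ∘ q} λ i →
        span-resp-≈ᵖ {w = hat ∘ w} (hat-cong (proj₂ (q∈ i))) (span-member (hat ∘ w) (proj₁ (q∈ i))))

  affine⇒aff : {w : Vector (Point d) n} → Affine w ⊆ aff (range w)
  affine⇒aff {w = w} (c , eq) = let (Σ≈1 , x≈) = hat-combination⁻ c w eq in
    _ , w , c , (λ i → i , λ _ → refl) , Σ≈1 , x≈

  val : Point (suc d) → Point d → ℝ
  val f x = ⟨ hat x , f ⟩

  val-cong : (f : Point (suc d)) {x y : Point d} → x ≈ᵖ y → val f x ≈ val f y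
  val-cong f x≈y = ⟨⟩-congˡ f (hat-cong x≈y)

  affine-annihilated : (f : Point (suc d)) {w : Vector (Point d) n} {x : Point d} →
                       (∀ i → val f (w i) ≈ 0#) → Affine w x → val f x ≈ 0#
  affine-annihilated f {w} {x} = span-annihilated {w = hat ∘ w} {hat x} f

  val-combination : (f : Point (suc d)) (c : Vector ℝ n) (q : Vector (Point d) n) {x : Point d} →
                    sum c ≈ 1# → x ≈ᵖ combination c q → val f x ≈ sum (λ i → c i * val f (q i))
  val-combination f c q Σ≈1 x≈ = trans (⟨⟩-congˡ f (hat-combination⁺ c q Σ≈1 x≈)) (⟨⟩-combination c (hat ∘ q) f)

  opaque
    conv-nonNeg : (X : Pred (Point d) 0ℓ) (f : Point (suc d)) → (∀ {y} → y ∈ X → 0# ≤ val f y) → ∀ {x} → x ∈ conv X → 0# ≤ val f x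
    conv-nonNeg X f 0≤f (_ , q , c , q∈ , 0≤c , Σ≈1 , x≈) =
      ≤-respʳ-≈ (sym (val-combination f c q Σ≈1 x≈)) (sum-nonNeg _ λ i → *-nonNeg (0≤c i) (0≤f (q∈ i)))

  conv-nonPos : (X : Pred (Point d) 0ℓ) (f : Point (suc d)) → (∀ {y} → y ∈ X → val f y ≤ 0#) → ∀ {x} → x ∈ conv X → val f x ≤ 0#
  conv-nonPos X f f≤0 (_ , q , c , q∈ , 0≤c , Σ≈1 , x≈) =
    ≤-respˡ-≈ (sym (val-combination f c q Σ≈1 x≈)) (sum-nonPos _ λ i →
      ≤-respʳ-≈ (zeroˡ (c i)) (≤-respˡ-≈ (*-comm (val f (q i)) (c i)) (*-monoʳ-≤ (0≤c i) (f≤0 (q∈ i)))))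

  opaque
    conv-zero : (X : Pred (Point d) 0ℓ) (f : Point (suc d)) → (∀ {y} → y ∈ X → val f y ≈ 0#) → ∀ {x} → x ∈ conv X → val f x ≈ 0#
    conv-zero X f f≈0 x∈ = antisym (conv-nonPos X f (≤-reflexive ∘ f≈0) x∈) (conv-nonNeg X f (≤-reflexive ∘ sym ∘ f≈0) x∈)

  opaque
    conv-pos : (X : Pred (Point d) 0ℓ) (f : Point (suc d)) {x : Point d} → x ∈ conv X → 0# < val f x → ∃[ y ] y ∈ X × 0# < val f y
    conv-pos X f x∈ (0≤ , 0≉) = by-contradiction λ ∄ →
      0≉ (antisym 0≤ (conv-nonPos X f (λ {y} y∈ → nonPos λ 0<y → ∄ (y , y∈ , 0<y)) x∈))
      where
      nonPos : ∀ {r} → ¬ 0# < r → r ≤ 0#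
      nonPos {r} 0≮r with total r 0#
      ... | inj₁ r≤0 = r≤0
      ... | inj₂ 0≤r = ≤-reflexive (sym (by-contradiction λ 0≉r → 0≮r (0≤r , 0≉r)))

  conv-mono : (X Y : Pred (Point d) 0ℓ) → X ⊆ Y → conv X ⊆ conv Y
  conv-mono X Y X⊆Y (n , q , c , q∈ , rest) = n , q , c , X⊆Y ∘ q∈ , rest

  conv-member : (X : Pred (Point d) 0ℓ) → X ⊆ conv X
  conv-member X {x} x∈ = 1 , (λ _ → x) , (λ _ → 1#) , (λ _ → x∈) , (λ _ → 0≤1)
    , +-identityʳ 1# , λ j → sym (trans (+-identityʳ _) (*-identityˡ (x j)))

  conv-resp-≈ᵖ : {X : Pred (Point d) 0ℓ} {x y : Point d} → x ≈ᵖ y → y ∈ conv X → x ∈ conv X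
  conv-resp-≈ᵖ x≈y (n , q , c , q∈ , 0≤c , Σ≈1 , y≈) = n , q , c , q∈ , 0≤c , Σ≈1 , λ j → trans (x≈y j) (y≈ j)

  conv⇒affine : {X : Pred (Point d) 0ℓ} {w : Vector (Point d) n} → X ⊆ Affine w → conv X ⊆ Affine w
  conv⇒affine {w = w} X⊆ (_ , q , c , q∈ , 0≤c , Σ≈1 , x≈) = span-resp-≈ᵖ {w = hat ∘ w} (hat-combination⁺ c q Σ≈1 x≈)
    (span-combination {w = hat ∘ w} c {hat ∘ q} (X⊆ ∘ q∈))

  range⊆affine : {w : Vector (Point d) n} → range w ⊆ Affine w
  range⊆affine {w = w} (i , x≈) = span-resp-≈ᵖ {w = hat ∘ w} (hat-cong x≈) (span-member (hat ∘ w) i)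

  -- A hull is the slice at height 1 of the cone over the lifted points: coordinate 0 forces the
  -- weights to sum to 1. Cones have their weights on the fixed family `p`, so nested convex
  -- combinations collapse by matrix multiplication.
  cone⇒conv : {p : Vector (Point d) n} {x : Point d} → Cone (hat ∘ p) (hat x) → x ∈ conv (range p)
  cone⇒conv {p = p} (c , 0≤c , eq) = let (Σ≈1 , x≈) = hat-combination⁻ c p eq in
    _ , p , c , (λ i → i , λ _ → refl) , 0≤c , Σ≈1 , x≈

  conv-cone : {X : Pred (Point d) 0ℓ} {p : Vector (Point d) n} → (∀ {y} → y ∈ X → Cone (hat ∘ p) (hat y)) →
              ∀ {x} → x ∈ conv X → Cone (hat ∘ p) (hat x)
  conv-cone {p = p} X⊆ (_ , q , c , q∈ , 0≤c , Σ≈1 , x≈) =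
    let (e , 0≤e , eq) = cone-combination {w = hat ∘ p} c {hat ∘ q} 0≤c (X⊆ ∘ q∈) in
    e , 0≤e , λ j → trans (hat-combination⁺ c q Σ≈1 x≈ j) (eq j)

  conv⇒cone : {p : Vector (Point d) n} {x : Point d} → x ∈ conv (range p) → Cone (hat ∘ p) (hat x)
  conv⇒cone {p = p} = conv-cone {X = range p} {p} λ (i , y≈) →
    let (e , 0≤e , eq) = cone-member (hat ∘ p) i in e , 0≤e , λ j → trans (hat-cong y≈ j) (eq j)

  conv-convex : {X : Pred (Point d) 0ℓ} {p : Vector (Point d) n} → X ⊆ conv (range p) → conv X ⊆ conv (range p)
  conv-convex {p = p} X⊆ x∈ = cone⇒conv {p = p} (conv-cone {p = p} (conv⇒cone {p = p} ∘ X⊆) x∈)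

  opaque
    -- The products of weight and value are nonnegative with sum 0, so each is 0: only points of
    -- weight 0 can lie off the hyperplane.
    conv-tight : (X : Pred (Point d) 0ℓ) (f : Point (suc d)) → (∀ {y} → y ∈ X → 0# ≤ val f y) →
                 ∀ {x} → x ∈ conv X → val f x ≈ 0# → x ∈ conv (λ y → y ∈ X × val f y ≈ 0#)
    conv-tight {d} X f 0≤f {x} (n , q , c , q∈ , 0≤c , Σ≈1 , x≈) fx≈0 =
      n , q′ , c , q′∈ , 0≤c , Σ≈1 , λ j → trans (x≈ j) (sum-cong-≋ λ i → replace i j)
      where
      c*f≈0 : ∀ i → c i * val f (q i) ≈ 0#
      c*f≈0 = sum-nonNeg-zero _ (λ i → *-nonNeg (0≤c i) (0≤f (q∈ i))) (trans (sym (val-combination f c q Σ≈1 x≈)) fx≈0)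

      ∃c≉0 : ∃[ i ] ¬ c i ≈ 0#
      ∃c≉0 = by-contradiction λ ∄ → 0≉1 (trans (sym (sum-zero c λ i → by-contradiction λ ci≉0 → ∄ (i , ci≉0))) Σ≈1)

      i₀ : Fin n
      i₀ = proj₁ ∃c≉0

      -- The points of weight 0 are replaced by one of nonzero weight.
      q′ : Vector (Point d) n
      q′ i with em (c i ≈ 0#)
      ... | yes _ = q i₀
      ... | no  _ = q i

      q′∈ : ∀ i → q′ i ∈ X × val f (q′ i) ≈ 0#
      q′∈ i with em (c i ≈ 0#)
      ... | yes _   = q∈ i₀ , *-integral (proj₂ ∃c≉0) (c*f≈0 i₀)
      ... | no ci≉0 = q∈ i , *-integral ci≉0 (c*f≈0 i)

      replace : ∀ i j → c i * q i j ≈ c i * q′ i j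
      replace i j with em (c i ≈ 0#)
      ... | yes ci≈0 = trans (trans (*-congʳ ci≈0) (zeroˡ _)) (sym (trans (*-congʳ ci≈0) (zeroˡ _)))
      ... | no _     = refl

  -- Folding the offset into coordinate 0 makes the inequality homogeneous in `hat x`, so that faces
  -- can be handled by `separate` and linear combinations of functionals.
  functional : {X : Pred (Point d) 0ℓ} → Face X → Point (suc d)
  functional F = - Face.offset F ∷ Face.normal F

  value : {X : Pred (Point d) 0ℓ} → Face X → Point d → ℝ
  value F = val (functional F)

  value-nonNeg : {X : Pred (Point d) 0ℓ} (F : Face X) → ∀ {x} → x ∈ X → 0# ≤ value F x
  value-nonNeg F x∈ = ≤-respʳ-≈ (trans (+-comm _ _) (+-congʳ (sym (*-identityˡ _)))) (≤⇒0≤- (Face.valid F x∈))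

  H⇒value≈0 : {X : Pred (Point d) 0ℓ} (F : Face X) → ∀ {x} → x ∈ Face.H F → value F x ≈ 0#
  H⇒value≈0 F x∈H = trans (+-cong (*-identityˡ _) x∈H) (-‿inverseˡ _)

  value≈0⇒H : {X : Pred (Point d) 0ℓ} (F : Face X) → ∀ {x} → value F x ≈ 0# → x ∈ Face.H F
  value≈0⇒H F ≈0 = +-cancelˡ (- Face.offset F) _ _ (trans (trans (+-congʳ (sym (*-identityˡ _))) ≈0) (sym (-‿inverseˡ _)))

  points⇒value≈0 : {X : Pred (Point d) 0ℓ} (F : Face X) → ∀ {x} → x ∈ Face.points F → value F x ≈ 0#
  points⇒value≈0 F (_ , x∈H) = H⇒value≈0 F x∈H

  value≉0 : {X : Pred (Point d) 0ℓ} (F : Face X) → ∀ {x} → x ∈ X → x ∉ Face.points F → ¬ value F x ≈ 0#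
  value≉0 F x∈ x∉ ≈0 = x∉ (x∈ , value≈0⇒H F ≈0)

  face : (X : Pred (Point d) 0ℓ) (f : Point (suc d)) → (∀ {x} → x ∈ X → 0# ≤ val f x) → Face X
  face X f 0≤f = record
    { normal = tail f
    ; offset = - head f
    ; valid  = λ x∈ → 0≤-⇒≤ (≤-respʳ-≈ (trans (+-cong (trans (*-identityˡ _) (sym (-‿involutive _))) refl) (+-comm _ _)) (0≤f x∈))
    }

  value-face : (X : Pred (Point d) 0ℓ) (f : Point (suc d)) (0≤f : ∀ {x} → x ∈ X → 0# ≤ val f x) (x : Point d) →
               value (face X f 0≤f) x ≈ val f x
  value-face X f 0≤f x = +-congʳ (*-congˡ (-‿involutive _))

  face-points⁺ : (X : Pred (Point d) 0ℓ) (f : Point (suc d)) (0≤f : ∀ {x} → x ∈ X → 0# ≤ val f x) →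
                 ∀ {x} → x ∈ X → val f x ≈ 0# → x ∈ Face.points (face X f 0≤f)
  face-points⁺ X f 0≤f {x} x∈ ≈0 = x∈ , value≈0⇒H (face X f 0≤f) (trans (value-face X f 0≤f x) ≈0)

  face-points⁻ : (X : Pred (Point d) 0ℓ) (f : Point (suc d)) (0≤f : ∀ {x} → x ∈ X → 0# ≤ val f x) →
                 ∀ {x} → x ∈ Face.points (face X f 0≤f) → val f x ≈ 0#
  face-points⁻ X f 0≤f {x} x∈ = trans (sym (value-face X f 0≤f x)) (points⇒value≈0 (face X f 0≤f) x∈)

  Basis : Pred (Point d) 0ℓ → ℕ → Set
  Basis {d} X k = Σ[ w ∈ Vector (Point d) (suc k) ]
    (∀ i → w i ∈ X) × LinearlyIndependent (hat ∘ w) × X ⊆ Affine w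

  dim⇒basis : {X : Pred (Point d) 0ℓ} → HasDim X k → Basis X k
  dim⇒basis (w , w∈ , indep , X⊆) = w , w∈ , affinely⇒linearly w indep , aff⇒affine ∘ X⊆

  basis⇒dim : {X : Pred (Point d) 0ℓ} → Basis X k → HasDim X k
  basis⇒dim (w , w∈ , indep , X⊆) = w , w∈ , linearly⇒affinely w indep , affine⇒aff ∘ X⊆

  independent-bound : {u : Vector (Point d) m} {w : Vector (Point d) n} →
                      LinearlyIndependent (hat ∘ u) → (∀ i → Affine w (u i)) → m ≤ℕ n
  independent-bound {u = u} {w} = steinitz (hat ∘ u) (hat ∘ w)

  independent-size : {X : Pred (Point d) 0ℓ} {u : Vector (Point d) m} → LinearlyIndependent (hat ∘ u) → (∀ i → u i ∈ X) →
                     HasDim X k → m ≤ℕ suc k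
  independent-size {u = u} indep u∈ dimX with dim⇒basis dimX
  ... | w , _ , _ , X⊆ = independent-bound {u = u} {w} indep (X⊆ ∘ u∈)

  affinely-independent-∷ : {u : Point d} {w : Vector (Point d) n} → LinearlyIndependent (hat ∘ w) →
                           ¬ Affine w u → LinearlyIndependent (hat ∘ (u ∷ w))
  affinely-independent-∷ {u = u} {w} indep u∉ c c≈0 = independent-∷ {u = hat u} {hat ∘ w} indep u∉ c λ j → trans (unfold j) (c≈0 j)
    where
    unfold : combination c (hat u ∷ hat ∘ w) ≈ᵖ combination c (hat ∘ (u ∷ w))
    unfold j = refl

  opaque
    dim-mono : {X Y : Pred (Point d) 0ℓ} → X ⊆ Y → HasDim X j → HasDim Y k → j ≤ℕ k
    dim-mono X⊆Y dimX dimY with dim⇒basis dimX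
    ... | u , u∈ , indep , _ = s≤s⁻¹ (independent-size {u = u} indep (X⊆Y ∘ u∈) dimY)

  opaque
    -- The functional certifies that y is outside the affine hull of `X`, so y extends a basis of
    -- `X` to a longer independent family in `Y`.
    dim-strict : {X Y : Pred (Point d) 0ℓ} → X ⊆ Y → HasDim X j → HasDim Y k → (f : Point (suc d)) → (∀ {x} → x ∈ X → val f x ≈ 0#) →
                 ∀ {y} → y ∈ Y → ¬ val f y ≈ 0# → j <ℕ k
    dim-strict X⊆Y dimX dimY f f≈0 {y} y∈ fy≉0 with dim⇒basis dimX
    ... | u , u∈ , indep , _ = s≤s⁻¹ (independent-size {u = y ∷ u}
      (affinely-independent-∷ {u = y} {u} indep λ y∈span → fy≉0 (affine-annihilated f {u} (f≈0 ∘ u∈) y∈span))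
      (λ { zero → y∈ ; (suc i) → X⊆Y (u∈ i) }) dimY)

  opaque
    dim-full : {Y : Pred (Point d) 0ℓ} → HasDim Y k → (u : Vector (Point d) (suc k)) → (∀ i → u i ∈ Y) →
               LinearlyIndependent (hat ∘ u) → Y ⊆ Affine u
    dim-full dimY u u∈ indep {y} y∈ = by-contradiction λ y∉ → ℕ.n≮n _
      (independent-size {u = y ∷ u} (affinely-independent-∷ {u = y} {u} indep y∉) (λ { zero → y∈ ; (suc i) → u∈ i }) dimY)

  opaque
    -- Greedy extension of an independent family from the single point x. Each step raises `j` by
    -- one, and independent families in `Y` have at most k + 1 points, so k steps of fuel suffice.
    dim-exists : {X Y : Pred (Point d) 0ℓ} → X ⊆ Y → HasDim Y k → ∀ {x} → x ∈ X → ∃[ j ] HasDim X j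
    dim-exists {d} {k} {X} {Y} X⊆Y dimY {x} x∈ = extend k (ℕ.m≤m+n k 0) (λ _ → x) (λ _ → x∈)
      -- Coordinate 0 of a lifted point is 1, so one point is independent even if it is the origin.
      λ { c c≈0 zero → trans (trans (sym (*-identityʳ (c zero))) (sym (+-identityʳ _))) (c≈0 zero) }
      where
      extend : ∀ fuel {j} → k ≤ℕ fuel +ℕ j → (w : Vector (Point d) (suc j)) → (∀ i → w i ∈ X) →
               LinearlyIndependent (hat ∘ w) → ∃[ j ] HasDim X j
      extend fuel {j} k≤ w w∈ indep with em (∃[ y ] y ∈ X × ¬ Affine w y)
      ... | no ∄ = j , basis⇒dim (w , w∈ , indep , λ {y} y∈ → by-contradiction λ y∉ → ∄ (y , y∈ , y∉))
      ... | yes (y , y∈ , y∉) = continue fuel k≤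
        where
        yw∈ : ∀ i → (y ∷ w) i ∈ X
        yw∈ zero    = y∈
        yw∈ (suc i) = w∈ i

        indep′ : LinearlyIndependent (hat ∘ (y ∷ w))
        indep′ = affinely-independent-∷ {u = y} {w} indep y∉

        continue : ∀ fuel → k ≤ℕ fuel +ℕ j → ∃[ j ] HasDim X j
        continue zero       k≤j = contradiction
          (s≤s⁻¹ (independent-size {u = y ∷ w} indep′ (X⊆Y ∘ yw∈) dimY)) (ℕ.≤⇒≯ k≤j)
        continue (suc fuel) k≤  = extend fuel (≡.subst (k ≤ℕ_) (≡.sym (ℕ.+-suc fuel j)) k≤) (y ∷ w) yw∈ indep′

-- Existence and incidence of faces.

module Polytopes (𝓡 : CompleteOrderedField) where

  open CompleteOrderedField 𝓡 hiding (zero) renaming (Carrier to ℝ)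
  open OrderedField 𝓡
  open LinearAlgebra 𝓡
  open ConvexGeometry 𝓡
  open Geometry 𝓡
  open Face using (points)

  opaque
    ⊈⇒∃∉ : ∀ {d} {X Y : Pred (Point d) 0ℓ} → ¬ X ⊆ Y → ∃[ x ] x ∈ X × x ∉ Y
    ⊈⇒∃∉ X⊈Y = by-contradiction λ ∄ → X⊈Y λ {x} x∈ → by-contradiction λ x∉ → ∄ (x , x∈ , x∉)

  module _ {d} (X : Pred (Point d) 0ℓ) where

    val-0 : (x : Point d) → val (λ _ → 0#) x ≈ 0#
    val-0 x = sum-zero _ λ i → zeroʳ (hat x i)

    val-1 : (x : Point d) → val (1# ∷ λ _ → 0#) x ≈ 1#
    val-1 x = trans (+-cong (*-identityˡ 1#) (sum-zero _ λ i → zeroʳ (x i))) (+-identityʳ 1#)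

    whole : Face X
    whole = face X (λ _ → 0#) λ {x} _ → ≤-reflexive (sym (val-0 x))

    X⊆whole : X ⊆ points whole
    X⊆whole {x} x∈ = face-points⁺ X (λ _ → 0#) (λ {x} _ → ≤-reflexive (sym (val-0 x))) x∈ (val-0 x)

    empty : Face X
    empty = face X (1# ∷ λ _ → 0#) λ {x} _ → ≤-respʳ-≈ (sym (val-1 x)) 0≤1

    ∉empty : ∀ {x} → x ∉ points empty
    ∉empty {x} x∈ = 0≉1 (trans (sym (face-points⁻ X (1# ∷ λ _ → 0#) (λ {x} _ → ≤-respʳ-≈ (sym (val-1 x)) 0≤1) x∈)) (val-1 x))

  -- Faces of a simplex, described by vertices.

  module SimplexFaces {d n} (Δ : Pred (Point d) 0ℓ) (δ : Vector (Point d) (suc n))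
                      (independent : AffinelyIndependent δ) (Δ≐ : Δ ≐ conv (range δ)) where

    vertex∈ : ∀ i → δ i ∈ Δ
    vertex∈ i = proj₂ Δ≐ (conv-member (range δ) (i , λ _ → refl))

    nonNeg-on-Δ : (f : Point (suc d)) → (∀ i → 0# ≤ val f (δ i)) → ∀ {x} → x ∈ Δ → 0# ≤ val f x
    nonNeg-on-Δ f 0≤f x∈ = conv-nonNeg (range δ) f (λ (i , y≈) → ≤-respʳ-≈ (sym (val-cong f y≈)) (0≤f i)) (proj₁ Δ≐ x∈)

    -- By `conv-tight` a face is the hull of the vertices it contains, so inclusion can be tested at
    -- vertices.
    face⊆ : (E F : Face Δ) → (∀ i → δ i ∈ points E → value F (δ i) ≈ 0#) → E ⊑ F
    face⊆ E F vertices {x} x∈E = proj₁ x∈E , value≈0⇒H F (conv-zero (λ y → y ∈ range δ × value E y ≈ 0#) (functional F)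
      (λ ((i , y≈) , ≈0) → trans (val-cong (functional F) y≈)
        (vertices i (vertex∈ i , value≈0⇒H E (trans (sym (val-cong (functional E) y≈)) ≈0))))
      (conv-tight (range δ) (functional E)
        (λ (i , y≈) → ≤-respʳ-≈ (sym (val-cong (functional E) y≈)) (value-nonNeg E (vertex∈ i)))
        (proj₁ Δ≐ (proj₁ x∈E)) (points⇒value≈0 E x∈E)))

    separator : ∀ i → ∃[ f ] (∀ l → ⟨ hat (δ (punchIn i l)) , f ⟩ ≈ 0#) × 0# < ⟨ hat (δ i) , f ⟩
    separator i = separate⁺ (removeAt (hat ∘ δ) i) (hat (δ i))
      (independent⇒∉span-removeAt (hat ∘ δ) i (affinely⇒linearly δ independent))

    -- The barycentric coordinate of vertex i up to a positive factor, which does not affect the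
    -- face it defines.
    barycentric : Fin (suc n) → Point (suc d)
    barycentric i = proj₁ (separator i)

    barycentric-self : ∀ i → 0# < val (barycentric i) (δ i)
    barycentric-self i = proj₂ (proj₂ (separator i))

    barycentric-other : ∀ {i l} → l ≢ i → val (barycentric i) (δ l) ≈ 0#
    barycentric-other {i} {l} l≢i = ≡.subst (λ l → val (barycentric i) (δ l) ≈ 0#)
      (punchIn-punchOut (l≢i ∘ ≡.sym)) (proj₁ (proj₂ (separator i)) (punchOut (l≢i ∘ ≡.sym)))

    barycentric-nonNeg : ∀ i {x} → x ∈ Δ → 0# ≤ val (barycentric i) x
    barycentric-nonNeg i = nonNeg-on-Δ (barycentric i) at-vertex
      where
      at-vertex : ∀ l → 0# ≤ val (barycentric i) (δ l)
      at-vertex l with l ≟ i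
      ... | yes ≡.refl = proj₁ (barycentric-self i)
      ... | no l≢i     = ≤-reflexive (sym (barycentric-other l≢i))

    opposite : Fin (suc n) → Face Δ
    opposite i = face Δ (barycentric i) (barycentric-nonNeg i)

    opposite-vertex⁺ : ∀ {i l} → l ≢ i → δ l ∈ points (opposite i)
    opposite-vertex⁺ {i} {l} l≢i = face-points⁺ Δ (barycentric i) (barycentric-nonNeg i) (vertex∈ l) (barycentric-other l≢i)

    opposite-vertex⁻ : ∀ {i l} → δ l ∈ points (opposite i) → l ≢ i
    opposite-vertex⁻ {i} δ∈ ≡.refl = proj₂ (barycentric-self i)
      (sym (face-points⁻ Δ (barycentric i) (barycentric-nonNeg i) δ∈))

    ⊑-opposite : (E : Face Δ) {i : Fin (suc n)} → δ i ∉ points E → E ⊑ opposite i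
    ⊑-opposite E {i} δi∉ = face⊆ E (opposite i) λ l δl∈ →
      points⇒value≈0 (opposite i) (opposite-vertex⁺ λ { ≡.refl → δi∉ δl∈ })

    opposite-⊑ : (E : Face Δ) {i : Fin (suc n)} → (∀ {l} → l ≢ i → δ l ∈ points E) → opposite i ⊑ E
    opposite-⊑ E {i} δ∈ = face⊆ (opposite i) E λ l δl∈ → points⇒value≈0 E (δ∈ (opposite-vertex⁻ δl∈))

    whole-⊑ : (E : Face Δ) → (∀ i → δ i ∈ points E) → whole Δ ⊑ E
    whole-⊑ E δ∈ = face⊆ (whole Δ) E λ i _ → points⇒value≈0 E (δ∈ i)

    barycentric₂-nonNeg : ∀ i j {x} → x ∈ Δ → 0# ≤ val (barycentric i +[ 1# ] barycentric j) x
    barycentric₂-nonNeg i j {x} x∈ =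
      ≤-respʳ-≈ (sym (⟨⟩-+[]ʳ (hat x) (barycentric i) 1# (barycentric j)))
        (+-nonNeg (barycentric-nonNeg i x∈) (*-nonNeg 0≤1 (barycentric-nonNeg j x∈)))

    -- The face spanned by the vertices other than i and j: a sum of nonnegative functionals
    -- vanishes only where both do.
    opposite₂ : Fin (suc n) → Fin (suc n) → Face Δ
    opposite₂ i j = face Δ (barycentric i +[ 1# ] barycentric j) (barycentric₂-nonNeg i j)

    opposite₂-vertex⁺ : ∀ {i j l} → l ≢ i → l ≢ j → δ l ∈ points (opposite₂ i j)
    opposite₂-vertex⁺ {i} {j} {l} l≢i l≢j = face-points⁺ Δ (barycentric i +[ 1# ] barycentric j) (barycentric₂-nonNeg i j) (vertex∈ l) (begin
      val (barycentric i +[ 1# ] barycentric j) (δ l)          ≈⟨ ⟨⟩-+[]ʳ (hat (δ l)) (barycentric i) 1# (barycentric j) ⟩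
      val (barycentric i) (δ l) + 1# * val (barycentric j) (δ l) ≈⟨ +-cong (barycentric-other l≢i) (trans (*-identityˡ _) (barycentric-other l≢j)) ⟩
      0# + 0#                                                  ≈⟨ +-identityʳ 0# ⟩
      0#                                                       ∎)

    opposite₂-vertex⁻ : ∀ {i j l} → i ≢ j → δ l ∈ points (opposite₂ i j) → l ≢ i × l ≢ j
    opposite₂-vertex⁻ {i} {j} {l} i≢j δ∈ =
        (λ { ≡.refl → proj₂ (barycentric-self i) (sym (trans (sym (trans (+-congˡ (trans (*-identityˡ _) (barycentric-other i≢j))) (+-identityʳ _))) sum≈0)) })
      , (λ { ≡.refl → proj₂ (barycentric-self j) (sym (trans (sym (trans (+-cong (barycentric-other (i≢j ∘ ≡.sym)) (*-identityˡ _)) (+-identityˡ _))) sum≈0)) })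
      where
      sum≈0 : val (barycentric i) (δ l) + 1# * val (barycentric j) (δ l) ≈ 0#
      sum≈0 = trans (sym (⟨⟩-+[]ʳ (hat (δ l)) (barycentric i) 1# (barycentric j)))
                    (face-points⁻ Δ (barycentric i +[ 1# ] barycentric j) (barycentric₂-nonNeg i j) δ∈)

    opposite₂-⊑ˡ : ∀ {i j} → i ≢ j → opposite₂ i j ⊑ opposite i
    opposite₂-⊑ˡ {i} {j} i≢j = face⊆ (opposite₂ i j) (opposite i) λ l δl∈ →
      points⇒value≈0 (opposite i) (opposite-vertex⁺ (proj₁ (opposite₂-vertex⁻ i≢j δl∈)))

    opposite₂-⊑ʳ : ∀ {i j} → i ≢ j → opposite₂ i j ⊑ opposite j
    opposite₂-⊑ʳ {i} {j} i≢j = face⊆ (opposite₂ i j) (opposite j) λ l δl∈ →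
      points⇒value≈0 (opposite j) (opposite-vertex⁺ (proj₂ (opposite₂-vertex⁻ i≢j δl∈)))

  -- Faces of a full-dimensional polytope given by generators.

  module PolytopeFaces {d n} (P : Pred (Point d) 0ℓ) (p : Vector (Point d) n) (P≐ : P ≐ conv (range p))
                       (dimP : HasDim P d) where

    generator∈ : ∀ i → p i ∈ P
    generator∈ i = proj₂ P≐ (conv-member (range p) (i , λ _ → refl))

    Tight : Point (suc d) → Pred (Point d) 0ℓ
    Tight f y = ∃[ i ] y ≈ᵖ p i × val f (p i) ≈ 0#

    -- This makes faces finitely generated, so conditions on a face need checking only at the
    -- finitely many `p i` on it.
    tight-generators : (f : Point (suc d)) → (∀ i → 0# ≤ val f (p i)) → ∀ {x} → x ∈ P → val f x ≈ 0# → x ∈ conv (Tight f)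
    tight-generators f 0≤f x∈ ≈0 = conv-mono (λ y → y ∈ range p × val f y ≈ 0#) (Tight f)
      (λ ((i , y≈) , fy≈0) → i , y≈ , trans (sym (val-cong f y≈)) fy≈0)
      (conv-tight (range p) f (λ (i , y≈) → ≤-respʳ-≈ (sym (val-cong f y≈)) (0≤f i)) (proj₁ P≐ x∈) ≈0)

    dim-of : (F : Face P) → ∀ {x} → x ∈ points F → ∃[ j ] HasDim (points F) j
    dim-of F = dim-exists {X = points F} {P} proj₁ dimP

    opaque
      -- A functional f that is nonnegative on the face B becomes nonnegative on
      -- P when a large multiple of the functional of B is added to it.
      subface : (B : Face P) (f : Point (suc d)) → (∀ i → p i ∈ points B → 0# ≤ val f (p i)) →
                Σ[ E ∈ Face P ] E ⊑ B × (∀ {x} → x ∈ points E → val f x ≈ 0#)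
                              × (∀ {x} → x ∈ points B → val f x ≈ 0# → x ∈ points E)
      subface B f 0≤f = E , (λ x∈ → proj₁ x∈ , value≈0⇒H B (proj₁ (E⇒ x∈))) , proj₂ ∘ E⇒ , ⇒E
        where
        big : ∃[ s ] (∀ i → ¬ value B (p i) ≈ 0# → 0# < val f (p i) + s * value B (p i))
        big = bigMultiple (value B ∘ p) (val f ∘ p) (value-nonNeg B ∘ generator∈)

        s : ℝ
        s = proj₁ big

        g : Point (suc d)
        g = f +[ s ] functional B

        val-g : ∀ x → val g x ≈ val f x + s * value B x
        val-g x = ⟨⟩-+[]ʳ (hat x) f s (functional B)

        val-g-B : ∀ x → value B x ≈ 0# → val g x ≈ val f x
        val-g-B x ≈0 = trans (val-g x) (trans (+-congˡ (trans (*-congˡ ≈0) (zeroʳ s))) (+-identityʳ _))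

        0≤g : ∀ i → 0# ≤ val g (p i)
        0≤g i with em (value B (p i) ≈ 0#)
        ... | yes ≈0 = ≤-respʳ-≈ (sym (val-g-B (p i) ≈0)) (0≤f i (generator∈ i , value≈0⇒H B ≈0))
        ... | no  ≉0 = ≤-respʳ-≈ (sym (val-g (p i))) (proj₁ (proj₂ big i ≉0))

        -- Off `B` the large multiple leaves `g` strictly positive, which is what confines the new
        -- face to `B`.
        tight : ∀ i → val g (p i) ≈ 0# → value B (p i) ≈ 0#
        tight i ≈0 = by-contradiction λ ≉0 → proj₂ (proj₂ big i ≉0) (sym (trans (sym (val-g (p i))) ≈0))

        0≤g-P : ∀ {x} → x ∈ P → 0# ≤ val g x
        0≤g-P x∈ = conv-nonNeg (range p) g (λ (i , y≈) → ≤-respʳ-≈ (sym (val-cong g y≈)) (0≤g i)) (proj₁ P≐ x∈)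

        E : Face P
        E = face P g 0≤g-P

        E⇒ : ∀ {x} → x ∈ points E → value B x ≈ 0# × val f x ≈ 0#
        E⇒ {x} x∈ = ≈0 , trans (sym (val-g-B x ≈0)) (face-points⁻ P g 0≤g-P x∈)
          where
          ≈0 : value B x ≈ 0#
          ≈0 = conv-zero (Tight g) (functional B) (λ (i , y≈ , gi≈0) → trans (val-cong (functional B) y≈) (tight i gi≈0))
                 (tight-generators g 0≤g (proj₁ x∈) (face-points⁻ P g 0≤g-P x∈))

        ⇒E : ∀ {x} → x ∈ points B → val f x ≈ 0# → x ∈ points E
        ⇒E {x} x∈ ≈0 = face-points⁺ P g 0≤g-P (proj₁ x∈) (trans (val-g-B x (points⇒value≈0 B x∈)) ≈0)

    opaque
      -- The functional of `B` is nonnegative on all of `P`, so `subface` applies to it inside `A`.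
      intersection : (A B : Face P) → Σ[ E ∈ Face P ] E ⊑ A × E ⊑ B × (∀ {x} → x ∈ points A → x ∈ points B → x ∈ points E)
      intersection A B with subface A (functional B) (λ i _ → value-nonNeg B (generator∈ i))
      ... | E , E⊑A , E⇒ , ⇒E = E , E⊑A , (λ x∈ → proj₁ x∈ , value≈0⇒H B (E⇒ x∈))
                              , λ x∈A x∈B → ⇒E x∈A (points⇒value≈0 B x∈B)

    opaque
      -- The hyperplane of A is rotated, within the face B and about A and u,
      -- until it hits a generator of B outside A.
      intermediate : (A B : Face P) → A ⊑ B → ∀ {j m} → HasDim (points A) j → HasDim (points B) m → suc (suc j) ≤ℕ m →
                     ∀ {u} → u ∈ points B → u ∉ points A →
                     Σ[ E ∈ Face P ] A ⊑ E × E ⊑ B × u ∉ points E × ∃[ q ] q ∈ points E × q ∉ points A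
      intermediate A B A⊑B {j} {m} dimA dimB j+2≤m {u} u∈B u∉A with dim⇒basis {X = points A} dimA
      ... | w , w∈A , indep , A⊆ = E , A⊑E , proj₁ (proj₂ sub) , u∉E , p i , i∈E , i∉A
        where
        -- A basis of `B` has at least j + 3 points, too many for the affine hull of u and the j + 1
        -- basis points of `A`.
        ∃z : ∃[ z ] z ∈ points B × ¬ Affine (u ∷ w) z
        ∃z = by-contradiction λ ∄ → let (b , b∈ , indepB , _) = dim⇒basis {X = points B} dimB in
          ℕ.<⇒≱ (s≤s j+2≤m) (independent-bound {u = b} {u ∷ w} indepB λ i → by-contradiction λ b∉ → ∄ (b i , b∈ i , b∉))

        z : Point d
        z = proj₁ ∃z

        separator : ∃[ g ] (∀ i → val g ((u ∷ w) i) ≈ 0#) × 0# < val g z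
        separator = separate⁺ (hat ∘ (u ∷ w)) (hat z) (proj₂ (proj₂ ∃z))

        g : Point (suc d)
        g = proj₁ separator

        gw≈0 : ∀ i → val g ((u ∷ w) i) ≈ 0#
        gw≈0 = proj₁ (proj₂ separator)

        -- The ratio test runs over generators, so positivity of `g` at z is passed to a generator
        -- of `B`.
        positive : ∃[ i ] p i ∈ points B × 0# < val g (p i)
        positive with conv-pos (Tight (functional B)) g
                        (tight-generators (functional B) (value-nonNeg B ∘ generator∈) (proj₁ (proj₁ (proj₂ ∃z)))
                          (points⇒value≈0 B (proj₁ (proj₂ ∃z))))
                        (proj₂ (proj₂ separator))
        ... | y , (i , y≈ , Bi≈0) , 0≤gy , 0≉gy = i , (generator∈ i , value≈0⇒H B Bi≈0)
            , ≤-respʳ-≈ (val-cong g y≈) 0≤gy , λ 0≈ → 0≉gy (trans 0≈ (sym (val-cong g y≈)))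

        ratio : ∃[ t ] (∀ i → p i ∈ points B → 0# ≤ value A (p i) + - t * val g (p i))
                     × ∃[ i ] p i ∈ points B × 0# < val g (p i) × value A (p i) + - t * val g (p i) ≈ 0#
        ratio = ratioTest (value A ∘ p) (val g ∘ p) (λ i → p i ∈ points B) (value-nonNeg A ∘ generator∈) positive

        t : ℝ
        t = proj₁ ratio

        i : Fin n
        i = proj₁ (proj₂ (proj₂ ratio))

        -- As `g` vanishes on `A` and at u, the tilt keeps `A` tight and u strictly off. The
        -- generator that stops the rotation has `g` positive and is therefore outside `A`.
        f : Point (suc d)
        f = functional A +[ - t ] g

        val-f : ∀ x → val f x ≈ value A x + - t * val g x
        val-f x = ⟨⟩-+[]ʳ (hat x) (functional A) (- t) g

        val-f-⊥ : ∀ x → val g x ≈ 0# → val f x ≈ value A x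
        val-f-⊥ x gx≈0 = trans (val-f x) (trans (+-congˡ (trans (*-congˡ gx≈0) (zeroʳ (- t)))) (+-identityʳ _))

        A⊥g : ∀ {x} → x ∈ points A → val g x ≈ 0#
        A⊥g x∈ = affine-annihilated g {w} (gw≈0 ∘ suc) (A⊆ x∈)

        sub : Σ[ E ∈ Face P ] E ⊑ B × (∀ {x} → x ∈ points E → val f x ≈ 0#)
                            × (∀ {x} → x ∈ points B → val f x ≈ 0# → x ∈ points E)
        sub = subface B f λ i i∈B → ≤-respʳ-≈ (sym (val-f (p i))) (proj₁ (proj₂ ratio) i i∈B)

        E : Face P
        E = proj₁ sub

        A⊑E : A ⊑ E
        A⊑E {x} x∈ = proj₂ (proj₂ (proj₂ sub)) (A⊑B x∈) (trans (val-f-⊥ x (A⊥g x∈)) (points⇒value≈0 A x∈))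

        u∉E : u ∉ points E
        u∉E u∈E = value≉0 A (proj₁ u∈B) u∉A (trans (sym (val-f-⊥ u (gw≈0 zero))) (proj₁ (proj₂ (proj₂ sub)) u∈E))

        i∈E : p i ∈ points E
        i∈E = let (_ , _ , _ , i∈B , _ , tight) = ratio in proj₂ (proj₂ (proj₂ sub)) i∈B (trans (val-f (p i)) tight)

        i∉A : p i ∉ points A
        i∉A i∈A = let (_ , _ , _ , _ , (_ , 0≉gi) , _) = ratio in 0≉gi (sym (A⊥g i∈A))

    strict : (A B : Face P) → A ⊑ B → ∀ {j m} → HasDim (points A) j → HasDim (points B) m →
             ∀ {u} → u ∈ points B → u ∉ points A → j <ℕ m
    strict A B A⊑B dimA dimB u∈B u∉A = dim-strict {X = points A} {points B} A⊑B dimA dimB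
      (functional A) (points⇒value≈0 A) u∈B (value≉0 A (proj₁ u∈B) u∉A)

    opaque
      -- `intermediate` gives a face strictly between `A` and `B`, of unknown dimension. The search
      -- continues on the side where i lies; the gap between the two dimensions shrinks either way,
      -- and fuel bounds it.
      superface : ∀ fuel (A B : Face P) → A ⊑ B → ∀ {j m} i → HasDim (points A) j → HasDim (points B) m →
                  m ≤ℕ fuel +ℕ j → j ≤ℕ i → i ≤ℕ m → Σ[ E ∈ Face P ] A ⊑ E × HasDim (points E) i
      superface fuel A B A⊑B {j} {m} i dimA dimB m≤ j≤i i≤m with j ℕ.≟ i | m ℕ.≟ i
      ... | yes ≡.refl | _          = A , id , dimA
      ... | no _       | yes ≡.refl = B , A⊑B , dimB
      ... | no j≢i     | no m≢i     = continue fuel m≤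
        where
        j+1≤i : j <ℕ i
        j+1≤i = ℕ.≤∧≢⇒< j≤i j≢i

        j+2≤m : suc (suc j) ≤ℕ m
        j+2≤m = ℕ.≤-<-trans j+1≤i (ℕ.≤∧≢⇒< i≤m (m≢i ∘ ≡.sym))

        j<m : j <ℕ m
        j<m = ℕ.<-≤-trans j+1≤i i≤m

        ∃u : ∃[ u ] u ∈ points B × u ∉ points A
        ∃u = ⊈⇒∃∉ {X = points B} {points A} λ B⊆A → ℕ.<⇒≱ j<m (dim-mono {X = points B} {points A} B⊆A dimB dimA)

        continue : ∀ fuel → m ≤ℕ fuel +ℕ j → Σ[ E ∈ Face P ] A ⊑ E × HasDim (points E) i
        continue zero m≤j = contradiction m≤j (ℕ.<⇒≱ j<m)
        continue (suc fuel) m≤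
          with intermediate A B A⊑B dimA dimB j+2≤m (proj₁ (proj₂ ∃u)) (proj₂ (proj₂ ∃u))
        ... | E , A⊑E , E⊑B , u∉E , q , q∈E , q∉A with dim-of E q∈E
        ...   | e , dimE with ℕ.≤-total i e
        ...     | inj₁ i≤e = superface fuel A E A⊑E i dimA dimE
                  (s≤s⁻¹ (ℕ.≤-trans (strict E B E⊑B dimE dimB (proj₁ (proj₂ ∃u)) u∉E) m≤)) j≤i i≤e
        ...     | inj₂ e≤i with superface fuel E B E⊑B i dimE dimB m≤′ e≤i i≤m
          where
          m≤′ : m ≤ℕ fuel +ℕ e
          m≤′ = ℕ.≤-trans m≤ (ℕ.≤-trans (ℕ.≤-reflexive (≡.sym (ℕ.+-suc fuel j))) (ℕ.+-monoʳ-≤ fuel (strict A E A⊑E dimA dimE q∈E q∉A)))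
        ...       | F , E⊑F , dimF = F , E⊑F ∘ A⊑E , dimF

    dim-whole : HasDim (points (whole P)) d
    dim-whole = let (w , w∈ , indep , P⊆) = dimP in w , X⊆whole P ∘ w∈ , indep , P⊆ ∘ proj₁

    face-⊇-of-dim : (A : Face P) → ∀ {j} i → HasDim (points A) j → j ≤ℕ i → i ≤ℕ d →
                    Σ[ E ∈ Face P ] A ⊑ E × HasDim (points E) i
    face-⊇-of-dim A i dimA = superface d A (whole P) (X⊆whole P ∘ proj₁) i dimA dim-whole (ℕ.m≤m+n d _)

    -- Facets through a face of codimension 2.

    module _ {r} (codim2 : d ≡ suc (suc r)) (R : Face P) (dimR : HasDim (points R) r) where

      private
        opaque
          -- A face strictly between dimensions r and r + 2 can only be a facet, so here
          -- `intermediate` does determine the dimension.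
          facet-through : ∀ {u} → u ∈ P → u ∉ points R →
            Σ[ G ∈ Face P ] R ⊑ G × HasDim (points G) (suc r) × u ∉ points G × ∃[ q ] q ∈ points G × q ∉ points R
          facet-through {u} u∈ u∉R
            with intermediate R (whole P) (X⊆whole P ∘ proj₁) dimR dim-whole (ℕ.≤-reflexive (≡.sym codim2)) (X⊆whole P u∈) u∉R
          ... | G , R⊑G , _ , u∉G , q , q∈G , q∉R with dim-of G q∈G
          ...   | e , dimG = G , R⊑G , ≡.subst (HasDim (points G)) e≡r+1 dimG , u∉G , q , q∈G , q∉R
            where
            e≡r+1 : e ≡ suc r
            e≡r+1 = ℕ.≤-antisym
              (s≤s⁻¹ (≡.subst (e <ℕ_) codim2 (strict G (whole P) (X⊆whole P ∘ proj₁) dimG dim-whole (X⊆whole P u∈) u∉G)))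
              (strict R G R⊑G dimR dimG q∈G q∉R)

      opaque
        -- The freedom to choose the avoided point gives the second facet: it is made to miss a
        -- point of the first one outside `R`.
        two-facets : Σ[ G ∈ Face P ] Σ[ G′ ∈ Face P ] R ⊑ G × R ⊑ G′ ×
                     HasDim (points G) (suc r) × HasDim (points G′) (suc r) × ¬ G ≋ G′
        two-facets with ⊈⇒∃∉ {X = P} {points R} (λ P⊆R → ℕ.m+1+n≰m r {1}
                          (≡.subst (_≤ℕ r) (≡.trans codim2 (ℕ.+-comm 2 r)) (dim-mono {X = P} {points R} P⊆R dimP dimR)))
        ... | u , u∈ , u∉R with facet-through u∈ u∉R
        ...   | G , R⊑G , dimG , _ , q , q∈G , q∉R with facet-through (proj₁ q∈G) q∉R
        ...     | G′ , R⊑G′ , dimG′ , q∉G′ , _ = G , G′ , R⊑G , R⊑G′ , dimG , dimG′ , λ G≋G′ → q∉G′ (proj₁ G≋G′ q∈G)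

      private
        facet∖ridge : (F : Face P) → HasDim (points F) (suc r) → ∃[ x ] x ∈ points F × x ∉ points R
        facet∖ridge F dimF = ⊈⇒∃∉ {X = points F} {points R} λ F⊆R → ℕ.n≮n r (dim-mono {X = points F} {points R} F⊆R dimF dimR)

        -- A common point outside `R` would give the intersection dimension more than r. It would
        -- then exhaust both facets, whose dimension is r + 1, and they would coincide.
        ∉other-facet : (F G : Face P) → R ⊑ F → R ⊑ G → HasDim (points F) (suc r) → HasDim (points G) (suc r) →
                       ¬ F ≋ G → ∀ {x} → x ∈ points F → x ∉ points R → x ∉ points G
        ∉other-facet F G R⊑F R⊑G dimF dimG F≭G {x} x∈F x∉R x∈G with intersection F G
        ... | I , I⊑F , I⊑G , ⇒I with dim-of I (⇒I x∈F x∈G)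
        ...   | i , dimI = F≭G ( (λ y∈F → I⊑G (by-contradiction λ y∉I → large F I⊑F dimF y∈F y∉I))
                               , (λ y∈G → I⊑F (by-contradiction λ y∉I → large G I⊑G dimG y∈G y∉I)))
          where
          large : (E : Face P) → I ⊑ E → HasDim (points E) (suc r) → ∀ {y} → y ∈ points E → ¬ (y ∉ points I)
          large E I⊑E dimE y∈E y∉I = ℕ.<⇒≱ (strict I E I⊑E dimI dimE y∈E y∉I)
            (strict R I (λ z∈R → ⇒I (R⊑F z∈R) (R⊑G z∈R)) dimR dimI (⇒I x∈F x∈G) x∉R)

      opaque
        -- If R lay on three facets with functionals f₁, f₂, f₃, then a point of
        -- the third facet would be, modulo aff R, a nonnegative combination of
        -- points x and y of the first two, and f₃ > 0 at x and y.
        no-third-facet : (F₁ F₂ F₃ : Face P) → R ⊑ F₁ → R ⊑ F₂ → R ⊑ F₃ →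
                         HasDim (points F₁) (suc r) → HasDim (points F₂) (suc r) → HasDim (points F₃) (suc r) →
                         ¬ F₁ ≋ F₂ → ¬ F₁ ≋ F₃ → ¬ ¬ F₂ ≋ F₃
        no-third-facet F₁ F₂ F₃ R⊑F₁ R⊑F₂ R⊑F₃ dim₁ dim₂ dim₃ F₁≭F₂ F₁≭F₃ F₂≭F₃
          with facet∖ridge F₁ dim₁ | facet∖ridge F₂ dim₂ | facet∖ridge F₃ dim₃ | dim⇒basis {X = points R} dimR
        ... | x , x∈F₁ , x∉R | y , y∈F₂ , y∉R | z , z∈F₃ , z∉R | w , w∈R , indep , _ =
          -- Once α vanishes, the value of `F₂` at z is β times its value at y, which is 0; but z is
          -- not on `F₂`.
          value≉0 F₂ (proj₁ z∈F₃) z∉F₂ (begin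
            value F₂ z                              ≈⟨ at-z F₂ R⊑F₂ ⟩
            α * value F₂ x + β * value F₂ y         ≈⟨ +-cong (trans (*-congʳ α≈0) (zeroˡ _)) (trans (*-congˡ (points⇒value≈0 F₂ y∈F₂)) (zeroʳ β)) ⟩
            0# + 0#                                 ≈⟨ +-identityʳ 0# ⟩
            0#                                      ∎)
          where
          x∉F₂ : x ∉ points F₂
          x∉F₂ = ∉other-facet F₁ F₂ R⊑F₁ R⊑F₂ dim₁ dim₂ F₁≭F₂ x∈F₁ x∉R
          x∉F₃ : x ∉ points F₃
          x∉F₃ = ∉other-facet F₁ F₃ R⊑F₁ R⊑F₃ dim₁ dim₃ F₁≭F₃ x∈F₁ x∉R
          y∉F₁ : y ∉ points F₁
          y∉F₁ = ∉other-facet F₂ F₁ R⊑F₂ R⊑F₁ dim₂ dim₁ (λ (f , g) → F₁≭F₂ (g , f)) y∈F₂ y∉R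
          z∉F₂ : z ∉ points F₂
          z∉F₂ = ∉other-facet F₃ F₂ R⊑F₃ R⊑F₂ dim₃ dim₂ (λ (f , g) → F₂≭F₃ (g , f)) z∈F₃ z∉R

          R⊥ : (F : Face P) → R ⊑ F → ∀ i → value F (w i) ≈ 0#
          R⊥ F R⊑F i = points⇒value≈0 F (R⊑F (w∈R i))

          -- With the r + 1 basis points of `R` these are d + 1 independent points, so they span the
          -- whole space affinely.
          frame : Vector (Point d) (suc (suc (suc r)))
          frame = x ∷ y ∷ w

          frame∈ : ∀ i → frame i ∈ P
          frame∈ zero          = proj₁ x∈F₁
          frame∈ (suc zero)    = proj₁ y∈F₂
          frame∈ (suc (suc i)) = proj₁ (w∈R i)

          frame-independent : LinearlyIndependent (hat ∘ frame)
          frame-independent = affinely-independent-∷ {u = x} {y ∷ w}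
            (affinely-independent-∷ {u = y} {w} indep λ y∈ →
              value≉0 F₁ (proj₁ y∈F₂) y∉F₁ (affine-annihilated (functional F₁) {w} (R⊥ F₁ R⊑F₁) y∈))
            λ x∈ → value≉0 F₂ (proj₁ x∈F₁) x∉F₂ (affine-annihilated (functional F₂) {y ∷ w}
              (λ { zero → points⇒value≈0 F₂ y∈F₂ ; (suc i) → R⊥ F₂ R⊑F₂ i }) x∈)

          z∈span : Affine frame z
          z∈span = dim-full {Y = P} (≡.subst (HasDim P) codim2 dimP) frame frame∈ frame-independent (proj₁ z∈F₃)

          c : Vector ℝ (suc (suc (suc r)))
          c = proj₁ z∈span

          α β : ℝ
          α = c zero
          β = c (suc zero)

          at-z : (F : Face P) → R ⊑ F → value F z ≈ α * value F x + β * value F y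
          at-z F R⊑F = begin
            value F z                                                   ≈⟨ ⟨⟩-congˡ (functional F) (proj₂ z∈span) ⟩
            ⟨ combination c (hat ∘ frame) , functional F ⟩              ≈⟨ ⟨⟩-combination c (hat ∘ frame) (functional F) ⟩
            α * value F x + (β * value F y + sum (λ i → c (suc (suc i)) * value F (w i)))
              ≈⟨ +-congˡ (+-congˡ (sum-zero _ λ i → trans (*-congˡ (R⊥ F R⊑F i)) (zeroʳ (c (suc (suc i)))))) ⟩
            α * value F x + (β * value F y + 0#)                        ≈⟨ +-congˡ (+-identityʳ _) ⟩
            α * value F x + β * value F y                               ∎

          -- The functional of `F₂` vanishes at y and on `R` and so isolates α; that of `F₁`
          -- isolates β in the same way.
          0≤α : 0# ≤ α
          0≤α = nonNeg-cancel (value-nonNeg F₂ (proj₁ x∈F₁)) (value≉0 F₂ (proj₁ x∈F₁) x∉F₂)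
            (≤-respʳ-≈ (trans (at-z F₂ R⊑F₂) (trans (+-congˡ (trans (*-congˡ (points⇒value≈0 F₂ y∈F₂)) (zeroʳ β))) (+-identityʳ _)))
              (value-nonNeg F₂ (proj₁ z∈F₃)))

          0≤β : 0# ≤ β
          0≤β = nonNeg-cancel (value-nonNeg F₁ (proj₁ y∈F₂)) (value≉0 F₁ (proj₁ y∈F₂) y∉F₁)
            (≤-respʳ-≈ (trans (at-z F₁ R⊑F₁) (trans (+-congʳ (trans (*-congˡ (points⇒value≈0 F₁ x∈F₁)) (zeroʳ α))) (+-identityˡ _)))
              (value-nonNeg F₁ (proj₁ z∈F₃)))

          α*f₃x≈0 : α * value F₃ x ≈ 0#
          α*f₃x≈0 = antisym
            (≤-respʳ-≈ (trans (sym (at-z F₃ R⊑F₃)) (points⇒value≈0 F₃ z∈F₃))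
              (≤-respˡ-≈ (+-identityʳ _) (+-monoʳ-≤ _ (*-nonNeg 0≤β (value-nonNeg F₃ (proj₁ y∈F₂))))))
            (*-nonNeg 0≤α (value-nonNeg F₃ (proj₁ x∈F₁)))

          α≈0 : α ≈ 0#
          α≈0 = *-integral (value≉0 F₃ (proj₁ x∈F₁) x∉F₃) (trans (*-comm _ α) α*f₃x≈0)

-- Ridges of a facet that is combinatorially a simplex.

module Facets (𝓡 : CompleteOrderedField) where

  open CompleteOrderedField 𝓡 hiding (zero) renaming (Carrier to ℝ)
  open OrderedField 𝓡
  open LinearAlgebra 𝓡
  open ConvexGeometry 𝓡
  open Polytopes 𝓡
  open Geometry 𝓡
  open Face using (points)

  third : ∀ {n} {i j : Fin (suc (suc (suc n)))} → i ≢ j → ∃[ l ] l ≢ i × l ≢ j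
  third {n} {i} {j} i≢j = punchIn i (punchIn (punchOut i≢j) zero) , punchInᵢ≢i i _ ,
    λ l≡j → punchInᵢ≢i (punchOut i≢j) zero (punchIn-injective i _ _ (≡.trans l≡j (≡.sym (punchIn-punchOut i≢j))))

  module _ {d n} (P : Pred (Point d) 0ℓ) (p : Vector (Point d) n) (P≐ : P ≐ conv (range p)) (dimP : HasDim P d)
           {r} (S : Face P) (dimS : HasDim (points S) (suc (suc r)))
           (Δ : Pred (Point d) 0ℓ) (δ : Vector (Point d) (suc (suc (suc r))))
           (independent : AffinelyIndependent δ) (Δ≐ : Δ ≐ conv (range δ))
           (φ : Face (points S) → Face Δ) (φ-iso : IsOrderIsomorphism _≋_ _≋_ _⊑_ _⊑_ φ) where

    open PolytopeFaces P p P≐ dimP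
    open SimplexFaces Δ δ independent Δ≐
    open IsOrderIsomorphism φ-iso using (mono; cancel; surjective)

    private
      ψ : Face Δ → Face (points S)
      ψ D = proj₁ (surjective D)

      φψ⊑ : (D : Face Δ) → φ (ψ D) ⊑ D
      φψ⊑ D = proj₁ (proj₂ (surjective D) (id , id))

      ⊑φψ : (D : Face Δ) → D ⊑ φ (ψ D)
      ⊑φψ D = proj₂ (proj₂ (surjective D) (id , id))

      φ⊑⇒⊑ψ : (E : Face (points S)) (D : Face Δ) → φ E ⊑ D → E ⊑ ψ D
      φ⊑⇒⊑ψ E D φE⊑D = cancel {E} {ψ D} (⊑φψ D ∘ φE⊑D)

      ⊑φ⇒ψ⊑ : (E : Face (points S)) (D : Face Δ) → D ⊑ φ E → ψ D ⊑ E
      ⊑φ⇒ψ⊑ E D D⊑φE = cancel {ψ D} {E} (D⊑φE ∘ φψ⊑ D)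

      whole⊑φ-whole : whole Δ ⊑ φ (whole (points S))
      whole⊑φ-whole = mono {ψ (whole Δ)} {whole (points S)} (X⊆whole (points S) ∘ proj₁) ∘ ⊑φψ (whole Δ)

      restrict : Face P → Face (points S)
      restrict E = record { normal = Face.normal E ; offset = Face.offset E ; valid = Face.valid E ∘ proj₁ }

      opaque
        -- The image of `R` misses a vertex, as otherwise `R` would be all of `S`; hence it lies in
        -- the face opposite that vertex. The preimage of this opposite face is a proper face of `S`
        -- containing `R`, and between dimensions r + 1 and r + 2 there is no room for it to be
        -- larger than `R`.
        ridge≋opposite : (R : Face (points S)) → HasDim (points R) (suc r) → ∃[ i ] φ R ⊑ opposite i × opposite i ⊑ φ R
        ridge≋opposite R dimR = i , ⊑-opposite (φ R) i∉ , ⊒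
          where
          missed : ∃[ i ] δ i ∉ points (φ R)
          missed = by-contradiction λ ∄ → ℕ.n≮n (suc r) (dim-mono {X = points S} {points R}
            (cancel {whole (points S)} {R}
              (λ x∈ → whole-⊑ (φ R) (λ i → by-contradiction λ i∉ → ∄ (i , i∉)) (X⊆whole Δ (proj₁ x∈)))
              ∘ X⊆whole (points S))
            dimS dimR)

          i : Fin (suc (suc (suc r)))
          i = proj₁ missed

          i∉ : δ i ∉ points (φ R)
          i∉ = proj₂ missed

          O : Face (points S)
          O = ψ (opposite i)

          R⊑O : R ⊑ O
          R⊑O = φ⊑⇒⊑ψ R (opposite i) (⊑-opposite (φ R) i∉)

          S⊈O : ∃[ y ] y ∈ points S × y ∉ points O
          S⊈O = ⊈⇒∃∉ {X = points S} {points O} λ S⊆O → opposite-vertex⁻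
            (φψ⊑ (opposite i) (mono {whole (points S)} {O} (S⊆O ∘ proj₁) (whole⊑φ-whole (X⊆whole Δ (vertex∈ i))))) ≡.refl

          O⊑R : O ⊑ R
          O⊑R {x} x∈O = by-contradiction λ x∉R →
            let (e , dimO)     = dim-exists {X = points O} {points S} proj₁ dimS x∈O
                (y , y∈ , y∉O) = S⊈O
            in ℕ.<⇒≱
              (dim-strict {X = points O} {points S} proj₁ dimO dimS (functional O) (points⇒value≈0 O) y∈ (value≉0 O y∈ y∉O))
              (dim-strict {X = points R} {points O} R⊑O dimR dimO (functional R) (points⇒value≈0 R) x∈O (value≉0 R (proj₁ x∈O) x∉R))

          ⊒ : opposite i ⊑ φ R
          ⊒ = mono {O} {R} O⊑R ∘ ⊑φψ (opposite i)

    opaque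
      -- The intersection `T` is a proper face of `R₁`, hence of dimension at most r. Were it
      -- smaller, `intermediate` would insert a face between `T` and `R₁`, while in the simplex
      -- nothing lies between the corresponding faces.
      common-subridge : (R₁ R₂ : Face P) → R₁ ⊑ S → R₂ ⊑ S → HasDim (points R₁) (suc r) → HasDim (points R₂) (suc r) →
                        ¬ R₁ ≋ R₂ → Σ[ T ∈ Face P ] T ⊑ R₁ × T ⊑ R₂ × HasDim (points T) r
      common-subridge R₁ R₂ R₁⊑S R₂⊑S dim₁ dim₂ R₁≭R₂ = T , T⊑R₁ , T⊑R₂ , dimT
        where
        restrict-dim : (R : Face P) → R ⊑ S → HasDim (points R) (suc r) → HasDim (points (restrict R)) (suc r)
        restrict-dim R R⊑S (w , w∈ , indep , R⊆) =
          w , (λ i → R⊑S (w∈ i) , proj₂ (w∈ i)) , indep , λ (x∈S , x∈H) → R⊆ (proj₁ x∈S , x∈H)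

        ρ₁ ρ₂ : Face (points S)
        ρ₁ = restrict R₁
        ρ₂ = restrict R₂

        opp₁ : ∃[ i ] φ ρ₁ ⊑ opposite i × opposite i ⊑ φ ρ₁
        opp₁ = ridge≋opposite ρ₁ (restrict-dim R₁ R₁⊑S dim₁)

        opp₂ : ∃[ i ] φ ρ₂ ⊑ opposite i × opposite i ⊑ φ ρ₂
        opp₂ = ridge≋opposite ρ₂ (restrict-dim R₂ R₂⊑S dim₂)

        i j : Fin (suc (suc (suc r)))
        i = proj₁ opp₁
        j = proj₁ opp₂

        φρ₁⊑ : φ ρ₁ ⊑ opposite i
        φρ₁⊑ = proj₁ (proj₂ opp₁)

        ⊑φρ₁ : opposite i ⊑ φ ρ₁
        ⊑φρ₁ = proj₂ (proj₂ opp₁)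

        φρ₂⊑ : φ ρ₂ ⊑ opposite j
        φρ₂⊑ = proj₁ (proj₂ opp₂)

        ⊑φρ₂ : opposite j ⊑ φ ρ₂
        ⊑φρ₂ = proj₂ (proj₂ opp₂)

        unrestrict : (E F : Face P) → E ⊑ S → φ (restrict E) ⊑ φ (restrict F) → E ⊑ F
        unrestrict E F E⊑S φE⊑φF x∈E =
          let ((x∈P , _) , x∈F) = cancel {restrict E} {restrict F} φE⊑φF (E⊑S x∈E , proj₂ x∈E) in x∈P , x∈F

        i≢j : i ≢ j
        i≢j i≡j = R₁≭R₂
          ( unrestrict R₁ R₂ R₁⊑S (⊑φρ₂ ∘ ≡.subst (λ i → φ ρ₁ ⊑ opposite i) i≡j φρ₁⊑)
          , unrestrict R₂ R₁ R₂⊑S (⊑φρ₁ ∘ ≡.subst (λ j → φ ρ₂ ⊑ opposite j) (≡.sym i≡j) φρ₂⊑))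

        meet : Σ[ E ∈ Face P ] E ⊑ R₁ × E ⊑ R₂ × (∀ {x} → x ∈ points R₁ → x ∈ points R₂ → x ∈ points E)
        meet = intersection R₁ R₂

        T : Face P
        T = proj₁ meet

        T⊑R₁ : T ⊑ R₁
        T⊑R₁ = proj₁ (proj₂ meet)

        T⊑R₂ : T ⊑ R₂
        T⊑R₂ = proj₁ (proj₂ (proj₂ meet))

        D : Face Δ
        D = opposite₂ i j

        ψD⊆T : points (ψ D) ⊆ points T
        ψD⊆T x∈ = proj₂ (proj₂ (proj₂ meet))
          (back R₁ (⊑φ⇒ψ⊑ ρ₁ D (⊑φρ₁ ∘ opposite₂-⊑ˡ i≢j) x∈))
          (back R₂ (⊑φ⇒ψ⊑ ρ₂ D (⊑φρ₂ ∘ opposite₂-⊑ʳ i≢j) x∈))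
          where
          back : (R : Face P) → ∀ {x} → x ∈ points (restrict R) → x ∈ points R
          back R (x∈S , x∈H) = proj₁ x∈S , x∈H

        -- The empty set has no dimension in the sense of `HasDim`, so this comes before measuring
        -- `T`. The simplex has r + 3 vertices, so one differs from both i and j and lies in `D`; an
        -- empty preimage of `D` would force `D` into the empty face.
        T-nonempty : ∃[ x ] x ∈ points T
        T-nonempty = by-contradiction λ ∄ →
          let (l , l≢i , l≢j) = third i≢j in
          ∉empty Δ (φψ⊑ (empty Δ) (mono {ψ D} {ψ (empty Δ)} (λ {x} x∈ → contradiction (x , ψD⊆T x∈) ∄)
            (⊑φψ D (opposite₂-vertex⁺ l≢i l≢j))))

        R₁⊈T : ∃[ u ] u ∈ points R₁ × u ∉ points T
        R₁⊈T = ⊈⇒∃∉ {X = points R₁} {points T} λ R₁⊆T → opposite-vertex⁻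
          (φρ₂⊑ (mono {ρ₁} {ρ₂} (λ (x∈S , x∈H) → x∈S , proj₂ (T⊑R₂ (R₁⊆T (proj₁ x∈S , x∈H))))
            (⊑φρ₁ (opposite-vertex⁺ {i} {j} (i≢j ∘ ≡.sym))))) ≡.refl

        -- In the simplex, opposite i covers opposite₂ i j.
        T-covered : (E : Face P) → T ⊑ E → E ⊑ R₁ → ∀ {u q} → u ∈ points R₁ → u ∉ points E → q ∈ points E → ¬ q ∉ points T
        -- The only vertex of `opposite i` outside `opposite₂ i j` is `δ j`. If the image of `E`
        -- contains it, then `E` is all of `R₁`; if not, then `E` lies in `R₂` and hence in `T`.
        T-covered E T⊑E E⊑R₁ u∈R₁ u∉E q∈E q∉T with em (δ j ∈ points (φ (restrict E)))
        ... | yes j∈ = u∉E (unrestrict R₁ E R₁⊑S (opposite-⊑ (φ (restrict E)) vertices ∘ φρ₁⊑) u∈R₁)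
          where
          D⊑φE : D ⊑ φ (restrict E)
          D⊑φE = mono {ψ D} {restrict E} (λ x∈ → proj₁ x∈ , proj₂ (T⊑E (ψD⊆T x∈))) ∘ ⊑φψ D

          vertices : ∀ {l} → l ≢ i → δ l ∈ points (φ (restrict E))
          vertices {l} l≢i with l ≟ j
          ... | yes ≡.refl = j∈
          ... | no l≢j     = D⊑φE (opposite₂-vertex⁺ l≢i l≢j)
        ... | no j∉ = q∉T (proj₂ (proj₂ (proj₂ meet)) (E⊑R₁ q∈E)
          (unrestrict E R₂ (R₁⊑S ∘ E⊑R₁) (⊑φρ₂ ∘ ⊑-opposite (φ (restrict E)) j∉) q∈E))

        choose : ∃[ t ] HasDim (points T) t → ∃[ u ] u ∈ points R₁ × u ∉ points T → HasDim (points T) r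
        choose (t , dimT) (u , u∈R₁ , u∉T) with t ℕ.≟ r
        ... | yes ≡.refl = dimT
        ... | no t≢r     =
          let (E , T⊑E , E⊑R₁ , u∉E , q , q∈E , q∉T) = intermediate T R₁ T⊑R₁ dimT dim₁
                (s≤s (ℕ.≤∧≢⇒< (s≤s⁻¹ (strict T R₁ T⊑R₁ dimT dim₁ u∈R₁ u∉T)) t≢r)) u∈R₁ u∉T
          in ⊥-elim (T-covered E T⊑E E⊑R₁ u∈R₁ u∉E q∈E q∉T)

        dimT : HasDim (points T) r
        dimT = choose (dim-of T (proj₂ T-nonempty)) R₁⊈T

-- Faces of the convex hull of a polytope and a point.

module Joins (𝓡 : CompleteOrderedField) where

  open CompleteOrderedField 𝓡 hiding (zero) renaming (Carrier to ℝ)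
  open OrderedField 𝓡
  open LinearAlgebra 𝓡
  open ConvexGeometry 𝓡
  open Polytopes 𝓡
  open Facets 𝓡
  open Geometry 𝓡
  open Face using (points)

  dim-resp-≐ : ∀ {d k} {X Y : Pred (Point d) 0ℓ} → X ≐ Y → HasDim X k → HasDim Y k
  dim-resp-≐ (X⊆Y , Y⊆X) (w , w∈ , indep , X⊆) = w , X⊆Y ∘ w∈ , indep , X⊆ ∘ Y⊆X

  simplex-resp-≐ : ∀ {d k} {X Y : Pred (Point d) 0ℓ} → X ≐ Y → IsSimplex k X → IsSimplex k Y
  simplex-resp-≐ (X⊆Y , Y⊆X) (w , indep , X⊆ , ⊆X) = w , indep , X⊆ ∘ Y⊆X , X⊆Y ∘ ⊆X

  module _ {d n} (P : Pred (Point d) 0ℓ) (p : Vector (Point d) n) (P≐ : P ≐ conv (range p)) (dimP : HasDim P d) where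

    open PolytopeFaces P p P≐ dimP

    P-convex : {X : Pred (Point d) 0ℓ} → X ⊆ P → conv X ⊆ P
    P-convex X⊆P = proj₂ P≐ ∘ conv-convex {p = p} (proj₁ P≐ ∘ X⊆P)

    P-resp-≈ᵖ : ∀ {x y} → x ≈ᵖ y → y ∈ P → x ∈ P
    P-resp-≈ᵖ x≈y y∈ = proj₂ P≐ (conv-resp-≈ᵖ {X = range p} x≈y (proj₁ P≐ y∈))

    ⊆conv-removeAt : ∀ {m} (F : Face P) (w : Vector (Point d) (suc m)) → (∀ i → w i ∈ P) →
                     points F ⊆ conv (range w) → ∀ {i} → w i ∉ points F → points F ⊆ conv (range (removeAt w i))
    ⊆conv-removeAt F w w∈ F⊆ {i} wi∉ x∈ = conv-mono (λ y → y ∈ range w × value F y ≈ 0#) (range (removeAt w i)) drop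
      (conv-tight (range w) (functional F)
        (λ (l , y≈) → ≤-respʳ-≈ (sym (val-cong (functional F) y≈)) (value-nonNeg F (w∈ l)))
        (F⊆ x∈) (points⇒value≈0 F x∈))
      where
      drop : ∀ {y} → y ∈ range w × value F y ≈ 0# → y ∈ range (removeAt w i)
      drop ((l , y≈) , ≈0) with i ≟ l
      ... | yes ≡.refl = contradiction (w∈ i , value≈0⇒H F (trans (sym (val-cong (functional F) y≈)) ≈0)) wi∉
      ... | no i≢l     = punchOut i≢l , λ j → trans (y≈ j) (reflexive (≡.cong (λ t → w t j) (≡.sym (punchIn-punchOut i≢l))))

    opaque
      -- The j + 2 vertices of `F′` are too many for `F`, so one is missed and `F` lies in the hull
      -- of the other j + 1. If one of these were missed as well, j points would affinely span `F`,
      -- which has dimension j.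
      facet-of-simplex : (F F′ : Face P) → F ⊑ F′ → ∀ {j} → HasDim (points F) j → IsSimplex (suc j) (points F′) →
                         IsSimplex j (points F)
      facet-of-simplex F F′ F⊑F′ {j} dimF (δ , indep , F′⊆ , ⊆F′) =
        w , linearly⇒affinely w w-indep , F⊆ , λ x∈ →
          P-convex {range w} (λ (l , y≈) → P-resp-≈ᵖ y≈ (δ∈ (punchIn i l))) x∈ ,
          value≈0⇒H F (conv-zero (range w) (functional F)
            (λ (l , y≈) → trans (val-cong (functional F) y≈) (points⇒value≈0 F (w∈F l))) x∈)
        where
        δ∈ : ∀ l → δ l ∈ P
        δ∈ l = proj₁ (⊆F′ (conv-member (range δ) (l , λ _ → refl)))

        missed : ∃[ i ] δ i ∉ points F
        missed = by-contradiction λ ∄ → ℕ.n≮n (suc j)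
          (independent-size {X = points F} {u = δ} (affinely⇒linearly δ indep) (λ i → by-contradiction λ i∉ → ∄ (i , i∉)) dimF)

        i : Fin (suc (suc j))
        i = proj₁ missed

        w : Vector (Point d) (suc j)
        w = removeAt δ i

        w-indep : LinearlyIndependent (hat ∘ w)
        w-indep = independent-removeAt (hat ∘ δ) i (affinely⇒linearly δ indep)

        F⊆ : points F ⊆ conv (range w)
        F⊆ = ⊆conv-removeAt F δ δ∈ (F′⊆ ∘ F⊑F′) (proj₂ missed)

        w∈F : ∀ l → w l ∈ points F
        w∈F l = by-contradiction λ l∉ → let (b , b∈ , b-indep , _) = dim⇒basis {X = points F} dimF in
          ℕ.n≮n j (independent-bound {u = b} {removeAt w l} b-indep λ t →
            conv⇒affine {X = range (removeAt w l)} {removeAt w l} (range⊆affine {w = removeAt w l})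
              (⊆conv-removeAt F w (δ∈ ∘ punchIn i) F⊆ l∉ (b∈ t)))

    module _ (v : Point d) where

      private
        Q : Pred (Point d) 0ℓ
        Q = conv (P ∪ singleton v)

      trace : Face Q → Face P
      trace G = record { normal = Face.normal G ; offset = Face.offset G ; valid = Face.valid G ∘ conv-member (P ∪ singleton v) ∘ inj₁ }

      trace⊆ : (G : Face Q) → points (trace G) ⊆ points G
      trace⊆ G (x∈P , x∈H) = conv-member (P ∪ singleton v) (inj₁ x∈P) , x∈H

      tight⊆ : (G : Face Q) → points G ⊆ conv (λ y → y ∈ P ∪ singleton v × value G y ≈ 0#)
      tight⊆ G x∈ = conv-tight (P ∪ singleton v) (functional G) (value-nonNeg G ∘ conv-member (P ∪ singleton v))
        (proj₁ x∈) (points⇒value≈0 G x∈)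

      ⊆trace : (G : Face Q) → ¬ value G v ≈ 0# → points G ⊆ points (trace G)
      ⊆trace G v∉ x∈ = P-convex {λ y → y ∈ P ∪ singleton v × value G y ≈ 0#} in-P (tight⊆ G x∈) , proj₂ x∈
        where
        in-P : ∀ {y} → y ∈ P ∪ singleton v × value G y ≈ 0# → y ∈ P
        in-P (inj₁ y∈P , _)  = y∈P
        in-P (inj₂ y≈v , ≈0) = contradiction (trans (sym (val-cong (functional G) y≈v)) ≈0) v∉

      ⊆conv-trace : (G : Face Q) → points G ⊆ conv (points (trace G) ∪ singleton v)
      ⊆conv-trace G x∈ = conv-mono (λ y → y ∈ P ∪ singleton v × value G y ≈ 0#) (points (trace G) ∪ singleton v)
        (λ { (inj₁ y∈P , ≈0) → inj₁ (y∈P , value≈0⇒H G ≈0) ; (inj₂ y≈v , _) → inj₂ y≈v }) (tight⊆ G x∈)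

      ⊆affine-∷ : (G : Face Q) → ∀ {m} (w : Vector (Point d) m) → points (trace G) ⊆ Affine w → points G ⊆ Affine (v ∷ w)
      ⊆affine-∷ G w F⊆ x∈ = conv⇒affine {X = points (trace G) ∪ singleton v} {v ∷ w} cases (⊆conv-trace G x∈)
        where
        cases : points (trace G) ∪ singleton v ⊆ Affine (v ∷ w)
        cases (inj₁ y∈F) = span-trans {w = hat ∘ (v ∷ w)} {q = hat ∘ w} (λ i → span-member (hat ∘ (v ∷ w)) (suc i)) (F⊆ y∈F)
        cases (inj₂ y≈v) = range⊆affine {w = v ∷ w} (zero , y≈v)

      pyramid : (G : Face Q) → value G v ≈ 0# → ∀ {j} → IsSimplex j (points (trace G)) →
                (∀ {m} (w : Vector (Point d) m) → (∀ i → w i ∈ points (trace G)) → ¬ Affine w v) →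
                IsSimplex (suc j) (points G)
      pyramid G v∈ {j} (w , indep , F⊆ , ⊆F) v∉aff = v ∷ w
        , linearly⇒affinely (v ∷ w) (affinely-independent-∷ {u = v} {w} (affinely⇒linearly w indep) (v∉aff w w∈F))
        , (λ x∈ → conv-convex {X = points (trace G) ∪ singleton v} {v ∷ w} cases (⊆conv-trace G x∈))
        , λ x∈ → conv-mono (range (v ∷ w)) (P ∪ singleton v)
            (λ { (zero , y≈) → inj₂ y≈ ; (suc l , y≈) → inj₁ (P-resp-≈ᵖ y≈ (proj₁ (w∈F l))) }) x∈
          , value≈0⇒H G (conv-zero (range (v ∷ w)) (functional G)
              (λ (l , y≈) → trans (val-cong (functional G) y≈) (vertex-tight l)) x∈)
        where
        w∈F : ∀ i → w i ∈ points (trace G)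
        w∈F i = ⊆F (conv-member (range w) (i , λ _ → refl))

        vertex-tight : ∀ l → value G ((v ∷ w) l) ≈ 0#
        vertex-tight zero    = v∈
        vertex-tight (suc l) = H⇒value≈0 G (proj₂ (w∈F l))

        cases : points (trace G) ∪ singleton v ⊆ conv (range (v ∷ w))
        cases (inj₁ y∈F) = conv-mono (range w) (range (v ∷ w)) (λ (l , y≈) → suc l , y≈) (F⊆ y∈F)
        cases (inj₂ y≈v) = conv-member (range (v ∷ w)) (zero , y≈v)

      -- The assumption about `Affine w v` leaves only two kinds of faces, those of `P` and pyramids
      -- over faces of `P`. The base of a pyramid is a simplex because it is a facet of a k-face of
      -- `P`.
      join-simplicial : ∀ k → 1 ≤ℕ k → k ≤ℕ d → IsSimplicial k P →
        ((F : Face P) → ∀ {j} → j ≤ℕ k → HasDim (points F) j →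
          ∀ {m} (w : Vector (Point d) m) → (∀ i → w i ∈ points F) → ¬ Affine w v) →
        IsSimplicial k Q
      join-simplicial k 1≤k k≤d simplicial excluded G dimG with em (value G v ≈ 0#)
      ... | no v∉ = simplex-resp-≐ {X = points (trace G)} {points G} (trace⊆ G , ⊆trace G v∉)
                      (simplicial (trace G) (dim-resp-≐ {X = points G} {points (trace G)} (⊆trace G v∉ , trace⊆ G) dimG))
      ... | yes v∈ with dim⇒basis {X = points G} dimG
      ...   | b , b∈ , b-indep , G⊆ = choose dimF
        where
        F : Face P
        F = trace G

        -- With an empty base, `G` would lie in the affine hull of v alone; this is where k ≥ 1
        -- enters.
        nonempty : ∃[ x ] x ∈ points F
        nonempty = by-contradiction λ ∄ → ℕ.<⇒≱ (s≤s 1≤k) (independent-bound {u = b} {v ∷ λ ()} b-indep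
          (⊆affine-∷ G (λ ()) (λ {x} x∈ → contradiction (x , x∈) ∄) ∘ b∈))

        dimF : ∃[ j ] HasDim (points F) j
        dimF = dim-of F (proj₂ nonempty)

        choose : ∃[ j ] HasDim (points F) j → IsSimplex k (points G)
        choose (j , dimF) = ≡.subst (λ k → IsSimplex k (points G)) (≡.sym k≡j+1) (pyramid G v∈
          (let (F′ , F⊑F′ , dimF′) = face-⊇-of-dim F k dimF j≤k k≤d in
            facet-of-simplex F F′ F⊑F′ dimF (≡.subst (λ k → IsSimplex k (points F′)) k≡j+1 (simplicial F′ dimF′)))
          (excluded F j≤k dimF))
          where
          j≤k : j ≤ℕ k
          j≤k = dim-mono {X = points F} {points G} (trace⊆ G) dimF dimG

          -- Adding v raises the dimension by at most one since `G` lies in the affine hull of v and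
          -- the base, and by at least one since v is outside the affine hull of the base.
          k≡j+1 : k ≡ suc j
          k≡j+1 = let (w , w∈ , w-indep , F⊆) = dim⇒basis {X = points F} dimF in ℕ.≤-antisym
            (s≤s⁻¹ (independent-bound {u = b} {v ∷ w} b-indep (⊆affine-∷ G w F⊆ ∘ b∈)))
            (s≤s⁻¹ (independent-size {X = points G} {u = v ∷ w}
              (affinely-independent-∷ {u = v} {w} w-indep (excluded F j≤k dimF w w∈))
              (λ { zero → conv-member (P ∪ singleton v) (inj₂ λ _ → refl) , value≈0⇒H G v∈ ; (suc i) → trace⊆ G (w∈ i) }) dimG))

-- Excluding the new point from the affine hulls of faces of dimension at most k.

theorem2p13 : (𝓡 : CompleteOrderedField) → let open Geometry 𝓡 in
    (d k : ℕ) → 3 ≤ℕ d → 1 ≤ℕ k → k ≤ℕ d ∸ 2 →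
    (P : Pred (Point d) 0ℓ) → IsPolytope P → HasDim P d → IsSimplicial k P →
    (S : Facet P) → IsSimplexFacet S → InBoundedPosition S →
    (𝓕 𝓝 : Pred (Facet P) 0ℓ) → 𝓕 Respects _≋ᶠ_ → 𝓝 Respects _≋ᶠ_ →
    𝓕 ⊆ adj S → 𝓝 ⊆ adj S → 𝓕 ⊥ 𝓝 → IsNonsimple S 𝓕 →
    (v : Point d) → v ∈ V S 𝓕 𝓝 → IsSimplicial k (conv (P ∪ singleton v))
theorem2p13 𝓡 (suc (suc (suc e))) k (s≤s (s≤s (s≤s z≤n))) 1≤k k≤d-2 P (n , p , P≐) dimP simplicial S
            (Δ , (δ , independent , Δ≐) , φ , φ-iso) _ 𝓕 𝓝 _ _ 𝓕⊆adj _ _ nonsimple v (v∈H⁻ , _ , v∈H⁺) =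
  join-simplicial P p P≐ dimP v k 1≤k (ℕ.≤-trans k≤d-2 (ℕ.m∸n≤m (suc (suc (suc e))) 2)) simplicial excluded
  where
  open CompleteOrderedField 𝓡 hiding (zero)
  open OrderedField 𝓡
  open ConvexGeometry 𝓡
  open Polytopes 𝓡
  open Facets 𝓡
  open Joins 𝓡
  open Geometry 𝓡
  open Face using (points)
  open PolytopeFaces P p P≐ dimP

  -- `V` puts v strictly on one side of the hyperplane of each facet outside `𝓕`: the negative side
  -- for `S` and the members of `𝓝`, the positive side for the rest.
  v∈H⇒∈𝓕 : (G : Facet P) → v ∈ Facet.H G → G ∈ 𝓕
  v∈H⇒∈𝓕 G v∈H = by-contradiction λ G∉𝓕 → proj₂
    (v∈H⁺ G (λ G∈𝓝 → proj₂ (v∈H⁻ G (inj₁ G∈𝓝)) v∈H) (λ G≋S → proj₂ (v∈H⁻ G (inj₂ G≋S)) v∈H) G∉𝓕) (sym v∈H)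

  excluded : (F : Face P) → ∀ {j} → j ≤ℕ k → HasDim (points F) j →
             ∀ {m} (w : Vector (Point _) m) → (∀ i → w i ∈ points F) → ¬ Affine w v
  excluded F j≤k dimF w w∈F v∈aff =
    let (R , F⊑R , dimR) = face-⊇-of-dim F (suc e) dimF (ℕ.≤-trans j≤k k≤d-2) (ℕ.m∸n≤m (suc (suc (suc e))) 2)
        (G , G′ , R⊑G , R⊑G′ , dimG , dimG′ , G≭G′) = two-facets ≡.refl R dimR
        -- The functional of a facet through `R` vanishes at the points `w`, hence on their affine
        -- hull, which contains v.
        ∈𝓕 : (X : Face P) (dimX : HasDim (points X) (suc (suc e))) → R ⊑ X → record { face = X ; dim = dimX } ∈ 𝓕
        ∈𝓕 X dimX R⊑X = v∈H⇒∈𝓕 _ (value≈0⇒H X {v}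
          (affine-annihilated (functional X) {w} {v} (λ i → points⇒value≈0 X (R⊑X (F⊑R (w∈F i)))) v∈aff))
        G∈𝓕  = ∈𝓕 G dimG R⊑G
        G′∈𝓕 = ∈𝓕 G′ dimG′ R⊑G′
        (G≭S , R₁ , dim₁ , R₁⊑G , R₁⊑S)    = 𝓕⊆adj G∈𝓕
        (G′≭S , R₂ , dim₂ , R₂⊑G′ , R₂⊑S) = 𝓕⊆adj G′∈𝓕
        (T , T⊑R₁ , T⊑R₂ , dimT) = common-subridge P p P≐ dimP (Facet.face S) (Facet.dim S) Δ δ independent Δ≐ φ φ-iso
          R₁ R₂ R₁⊑S R₂⊑S dim₁ dim₂ λ R₁≋R₂ →
            no-third-facet ≡.refl R₁ dim₁ G G′ (Facet.face S) R₁⊑G (λ x∈ → R₂⊑G′ (proj₁ R₁≋R₂ x∈)) R₁⊑S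
              dimG dimG′ (Facet.dim S) G≭G′ G≭S G′≭S
    in nonsimple (_ , _ , G∈𝓕 , G′∈𝓕 , (G≭G′ , R , dimR , R⊑G , R⊑G′) ,
         T , dimT , (λ x∈ → R₁⊑G (T⊑R₁ x∈)) , (λ x∈ → R₂⊑G′ (T⊑R₂ x∈)) , λ x∈ → R₁⊑S (T⊑R₁ x∈))
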